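{- Let $\Delta\ne0$ be some integer. Then for $X>0$ $$\sum_{\substack{r_1\\ (r_1,\Delta)=1}}\ \sum_{\substack{r_2\\ (r_2,\Delta)=1}}\ \sum_{\substack{d_1\\ q\mid d_1\Rightarrow q\mid\Delta}}\ \sum_{\substack{d_2\\ q\mid d_2\Rightarrow q\mid\Delta\\ [r_1^2d_1,r_2^2d_2]\le X}}1\le c(\Delta)\,\sqrt X\,\log^2X,$$ where $c(\Delta)$ is a constant depending only on $\Delta$.
   Context: $r_1,r_2,d_1,d_2$ run over positive integers; $q$ denotes primes, so "$q\mid d\Rightarrow q\mid\Delta$" means that every prime factor of $d$ divides $\Delta$. $(\cdot,\cdot)$ is the greatest common divisor and $[\cdot,\cdot]$ the least common multiple. $\log^2X=(\log X)^2$.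
   Formalization: The bound is stated for 0 < X < 1 and X ≥ 2 only: at X = 1 the left side is 1 while log²X = 0, so the claim fails for X = 1 and just above it for any c(Δ), and the range 1 ≤ X < 2 is left out. -}

module Defs where

open import Algebra.Bundles using (CommutativeMonoid)
open import Data.Nat.Base as ℕ using (ℕ; zero; suc; _!; _⊔_)
open import Data.Nat.Properties as ℕ using (_!≢0)
open import Data.Nat.LCM using (lcm)
open import Data.Nat.Divisibility as ℕ using ()
open import Data.Nat.Primality using (Prime)
open import Data.Integer.Base as ℤ using (ℤ; +_; 1ℤ)
open import Data.Integer.Divisibility as ℤ using ()
open import Data.Integer.GCD using (gcd)
open import Data.Rational.Base as ℚ using (ℚ; 0ℚ; 1ℚ; ½; ∣_∣; 1/_)
open import Data.Rational.Properties as ℚ using ()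
import Algebra.Properties.AbelianGroup ℚ.+-0-abelianGroup as ℚ+
import Algebra.Properties.CommutativeSemigroup as CommSemigroup
open import Data.List.Base using (List; length)
open import Data.List.Relation.Unary.All using (All)
open import Data.List.Relation.Unary.Unique.Propositional using (Unique)
open import Data.Product.Base using (_×_; _,_; proj₁; proj₂; ∃-syntax)
open import Relation.Binary.PropositionalEquality

infix  4 _≤ℝ_ _<ℝ_ _≈ℝ_
infixl 6 _+ℝ_
infixl 7 _*ℝ_
infixr 8 _^ℝ_

Eventually : (ℕ → Set) → Set
Eventually P = ∃[ N ] (∀ n → N ℕ.≤ n → P n)

-- The reals, as Cauchy sequences of rationals; equality of reals is _≈ℝ_.

IsCauchy : (ℕ → ℚ) → Set
IsCauchy s = ∀ ε → 0ℚ ℚ.< ε →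
  ∃[ N ] (∀ m n → N ℕ.≤ m → N ℕ.≤ n → ∣ s m ℚ.- s n ∣ ℚ.≤ ε)

record ℝ : Set where
  constructor mkℝ
  field
    seq    : ℕ → ℚ
    cauchy : IsCauchy seq
open ℝ public

_≤ℝ_ : ℝ → ℝ → Set
x ≤ℝ y = ∀ ε → 0ℚ ℚ.< ε → Eventually (λ n → seq x n ℚ.≤ seq y n ℚ.+ ε)

_<ℝ_ : ℝ → ℝ → Set
x <ℝ y = ∃[ ε ] (0ℚ ℚ.< ε × Eventually (λ n → seq x n ℚ.+ ε ℚ.≤ seq y n))

_≈ℝ_ : ℝ → ℝ → Set
x ≈ℝ y = x ≤ℝ y × y ≤ℝ x

fromℚ : ℚ → ℝ
fromℚ p = mkℝ (λ _ → p) λ ε 0<ε → 0 , λ _ _ _ _ →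
  subst (ℚ._≤ ε) (sym (cong ∣_∣ (ℚ.+-inverseʳ p))) (ℚ.<⇒≤ 0<ε)

fromℕ : ℕ → ℝ
fromℕ n = fromℚ (+ n ℚ./ 1)

private
  module ℚ* = CommSemigroup (CommutativeMonoid.commutativeSemigroup ℚ.*-1-commutativeMonoid)
  module ℚ+ₛ = CommSemigroup (CommutativeMonoid.commutativeSemigroup ℚ.+-0-commutativeMonoid)

  +-interchange : ∀ a b c d → (a ℚ.+ b) ℚ.- (c ℚ.+ d) ≡ (a ℚ.- c) ℚ.+ (b ℚ.- d)
  +-interchange a b c d = trans (cong ((a ℚ.+ b) ℚ.+_) (ℚ.neg-distrib-+ c d))
    (ℚ+ₛ.interchange a b (ℚ.- c) (ℚ.- d))

  add-sub : ∀ a b → a ≡ b ℚ.+ (a ℚ.- b)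
  add-sub a b = trans (sym (ℚ+.xyx⁻¹≈y b a)) (ℚ.+-assoc b a (ℚ.- b))

  *-distribˡ-- : ∀ a b c → a ℚ.* (b ℚ.- c) ≡ a ℚ.* b ℚ.- a ℚ.* c
  *-distribˡ-- a b c = trans (ℚ.*-distribˡ-+ a b (ℚ.- c))
    (cong (a ℚ.* b ℚ.+_) (sym (ℚ.neg-distribʳ-* a c)))

  *-telescope : ∀ a b c d → a ℚ.* b ℚ.- c ℚ.* d ≡ a ℚ.* (b ℚ.- d) ℚ.+ d ℚ.* (a ℚ.- c)
  *-telescope a b c d = sym (begin
    a ℚ.* (b ℚ.- d) ℚ.+ d ℚ.* (a ℚ.- c)
      ≡⟨ cong₂ ℚ._+_ (*-distribˡ-- a b d) (*-distribˡ-- d a c) ⟩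
    (a ℚ.* b ℚ.- a ℚ.* d) ℚ.+ (d ℚ.* a ℚ.- d ℚ.* c)
      ≡⟨ cong₂ (λ u v → (a ℚ.* b ℚ.- a ℚ.* d) ℚ.+ (u ℚ.- v)) (ℚ.*-comm d a) (ℚ.*-comm d c) ⟩
    (a ℚ.* b ℚ.- a ℚ.* d) ℚ.+ (a ℚ.* d ℚ.- c ℚ.* d)
      ≡⟨ ℚ.+-assoc (a ℚ.* b) (ℚ.- (a ℚ.* d)) _ ⟩
    a ℚ.* b ℚ.+ (ℚ.- (a ℚ.* d) ℚ.+ (a ℚ.* d ℚ.- c ℚ.* d))
      ≡⟨ cong (a ℚ.* b ℚ.+_) (sym (ℚ.+-assoc (ℚ.- (a ℚ.* d)) (a ℚ.* d) (ℚ.- (c ℚ.* d)))) ⟩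
    a ℚ.* b ℚ.+ (ℚ.- (a ℚ.* d) ℚ.+ a ℚ.* d ℚ.- c ℚ.* d)
      ≡⟨ cong (λ u → a ℚ.* b ℚ.+ (u ℚ.- c ℚ.* d)) (ℚ.+-inverseˡ (a ℚ.* d)) ⟩
    a ℚ.* b ℚ.+ (0ℚ ℚ.- c ℚ.* d)
      ≡⟨ cong (a ℚ.* b ℚ.+_) (ℚ.+-identityˡ (ℚ.- (c ℚ.* d))) ⟩
    a ℚ.* b ℚ.- c ℚ.* d ∎)
    where open ≡-Reasoning

+-isCauchy : ∀ {s t} → IsCauchy s → IsCauchy t → IsCauchy (λ n → s n ℚ.+ t n)
+-isCauchy {s} {t} cs ct ε 0<ε = M ⊔ N , bound
  where
  open ℚ.≤-Reasoning
  δ = ε ℚ.* ½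
  0<δ : 0ℚ ℚ.< δ
  0<δ = ℚ.positive⁻¹ δ {{ℚ.pos*pos⇒pos ε {{ℚ.positive 0<ε}} ½}}
  M = proj₁ (cs δ 0<δ)
  N = proj₁ (ct δ 0<δ)
  bound : ∀ m n → M ⊔ N ℕ.≤ m → M ⊔ N ℕ.≤ n →
          ∣ (s m ℚ.+ t m) ℚ.- (s n ℚ.+ t n) ∣ ℚ.≤ ε
  bound m n hm hn = begin
    ∣ (s m ℚ.+ t m) ℚ.- (s n ℚ.+ t n) ∣
      ≡⟨ cong ∣_∣ (+-interchange (s m) (t m) (s n) (t n)) ⟩
    ∣ (s m ℚ.- s n) ℚ.+ (t m ℚ.- t n) ∣
      ≤⟨ ℚ.∣p+q∣≤∣p∣+∣q∣ (s m ℚ.- s n) (t m ℚ.- t n) ⟩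
    ∣ s m ℚ.- s n ∣ ℚ.+ ∣ t m ℚ.- t n ∣
      ≤⟨ ℚ.+-mono-≤
           (proj₂ (cs δ 0<δ) m n (ℕ.m⊔n≤o⇒m≤o M N hm) (ℕ.m⊔n≤o⇒m≤o M N hn))
           (proj₂ (ct δ 0<δ) m n (ℕ.m⊔n≤o⇒n≤o M N hm) (ℕ.m⊔n≤o⇒n≤o M N hn)) ⟩
    δ ℚ.+ δ
      ≡⟨ sym (ℚ.*-distribˡ-+ ε ½ ½) ⟩
    ε ℚ.* 1ℚ
      ≡⟨ ℚ.*-identityʳ ε ⟩
    ε ∎

isCauchy⇒bounded : ∀ {s} → IsCauchy s →
  ∃[ B ] (ℚ.Positive B × Eventually (λ n → ∣ s n ∣ ℚ.≤ B))
isCauchy⇒bounded {s} cs =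
  B , ℚ.nonNeg+pos⇒pos ∣ s N ∣ {{ℚ.nonNegative (ℚ.0≤∣p∣ (s N))}} 1ℚ , N , bound
  where
  open ℚ.≤-Reasoning
  0<1 : 0ℚ ℚ.< 1ℚ
  0<1 = ℚ.positive⁻¹ 1ℚ
  N = proj₁ (cs 1ℚ 0<1)
  B = ∣ s N ∣ ℚ.+ 1ℚ
  bound : ∀ n → N ℕ.≤ n → ∣ s n ∣ ℚ.≤ B
  bound n hn = begin
    ∣ s n ∣
      ≡⟨ cong ∣_∣ (add-sub (s n) (s N)) ⟩
    ∣ s N ℚ.+ (s n ℚ.- s N) ∣
      ≤⟨ ℚ.∣p+q∣≤∣p∣+∣q∣ (s N) (s n ℚ.- s N) ⟩
    ∣ s N ∣ ℚ.+ ∣ s n ℚ.- s N ∣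
      ≤⟨ ℚ.+-monoʳ-≤ ∣ s N ∣ (proj₂ (cs 1ℚ 0<1) n N hn ℕ.≤-refl) ⟩
    B ∎

*-isCauchy : ∀ {s t} → IsCauchy s → IsCauchy t → IsCauchy (λ n → s n ℚ.* t n)
*-isCauchy {s} {t} cs ct ε 0<ε
  with A , A>0 , NA , hA ← isCauchy⇒bounded {s} cs
     | B , B>0 , NB , hB ← isCauchy⇒bounded {t} ct = K , bound
  where
  open ℚ.≤-Reasoning
  instance
    _ = A>0
    _ = B>0
    C>0 : ℚ.Positive (A ℚ.+ B)
    C>0 = ℚ.pos+pos⇒pos A B
    C≢0 : ℚ.NonZero (A ℚ.+ B)
    C≢0 = ℚ.pos⇒nonZero (A ℚ.+ B)
  δ = ε ℚ.* 1/ (A ℚ.+ B)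
  0<δ : 0ℚ ℚ.< δ
  0<δ = ℚ.positive⁻¹ δ
    {{ℚ.pos*pos⇒pos ε {{ℚ.positive 0<ε}} (1/ (A ℚ.+ B)) {{ℚ.1/pos⇒pos (A ℚ.+ B)}}}}
  M = proj₁ (cs δ 0<δ)
  N = proj₁ (ct δ 0<δ)
  K = (M ⊔ N) ⊔ (NA ⊔ NB)
  M⊔N≤ : ∀ {m} → K ℕ.≤ m → M ⊔ N ℕ.≤ m
  M⊔N≤ = ℕ.m⊔n≤o⇒m≤o (M ⊔ N) (NA ⊔ NB)
  NA⊔NB≤ : ∀ {m} → K ℕ.≤ m → NA ⊔ NB ℕ.≤ m
  NA⊔NB≤ = ℕ.m⊔n≤o⇒n≤o (M ⊔ N) (NA ⊔ NB)
  mul-mono : ∀ {a b c d} → 0ℚ ℚ.≤ c → 0ℚ ℚ.≤ b → a ℚ.≤ b → c ℚ.≤ d → a ℚ.* c ℚ.≤ b ℚ.* d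
  mul-mono {a} {b} {c} {d} 0≤c 0≤b a≤b c≤d = ℚ.≤-trans
    (ℚ.*-monoʳ-≤-nonNeg c {{ℚ.nonNegative 0≤c}} a≤b)
    (ℚ.*-monoˡ-≤-nonNeg b {{ℚ.nonNegative 0≤b}} c≤d)
  bound : ∀ m n → K ℕ.≤ m → K ℕ.≤ n → ∣ s m ℚ.* t m ℚ.- s n ℚ.* t n ∣ ℚ.≤ ε
  bound m n hm hn = begin
    ∣ s m ℚ.* t m ℚ.- s n ℚ.* t n ∣
      ≡⟨ cong ∣_∣ (*-telescope (s m) (t m) (s n) (t n)) ⟩
    ∣ s m ℚ.* (t m ℚ.- t n) ℚ.+ t n ℚ.* (s m ℚ.- s n) ∣
      ≤⟨ ℚ.∣p+q∣≤∣p∣+∣q∣ (s m ℚ.* (t m ℚ.- t n)) (t n ℚ.* (s m ℚ.- s n)) ⟩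
    ∣ s m ℚ.* (t m ℚ.- t n) ∣ ℚ.+ ∣ t n ℚ.* (s m ℚ.- s n) ∣
      ≡⟨ cong₂ ℚ._+_ (ℚ.∣p*q∣≡∣p∣*∣q∣ (s m) (t m ℚ.- t n))
                     (ℚ.∣p*q∣≡∣p∣*∣q∣ (t n) (s m ℚ.- s n)) ⟩
    ∣ s m ∣ ℚ.* ∣ t m ℚ.- t n ∣ ℚ.+ ∣ t n ∣ ℚ.* ∣ s m ℚ.- s n ∣
      ≤⟨ ℚ.+-mono-≤
           (mul-mono (ℚ.0≤∣p∣ (t m ℚ.- t n)) (ℚ.<⇒≤ (ℚ.positive⁻¹ A))
             (hA m (ℕ.m⊔n≤o⇒m≤o NA NB (NA⊔NB≤ hm)))
             (proj₂ (ct δ 0<δ) m n (ℕ.m⊔n≤o⇒n≤o M N (M⊔N≤ hm)) (ℕ.m⊔n≤o⇒n≤o M N (M⊔N≤ hn))))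
           (mul-mono (ℚ.0≤∣p∣ (s m ℚ.- s n)) (ℚ.<⇒≤ (ℚ.positive⁻¹ B))
             (hB n (ℕ.m⊔n≤o⇒n≤o NA NB (NA⊔NB≤ hn)))
             (proj₂ (cs δ 0<δ) m n (ℕ.m⊔n≤o⇒m≤o M N (M⊔N≤ hm)) (ℕ.m⊔n≤o⇒m≤o M N (M⊔N≤ hn)))) ⟩
    A ℚ.* δ ℚ.+ B ℚ.* δ
      ≡⟨ sym (ℚ.*-distribʳ-+ δ A B) ⟩
    (A ℚ.+ B) ℚ.* (ε ℚ.* 1/ (A ℚ.+ B))
      ≡⟨ ℚ*.x∙yz≈y∙xz (A ℚ.+ B) ε (1/ (A ℚ.+ B)) ⟩
    ε ℚ.* ((A ℚ.+ B) ℚ.* 1/ (A ℚ.+ B))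
      ≡⟨ cong (ε ℚ.*_) (ℚ.*-inverseʳ (A ℚ.+ B)) ⟩
    ε ℚ.* 1ℚ
      ≡⟨ ℚ.*-identityʳ ε ⟩
    ε ∎

_+ℝ_ : ℝ → ℝ → ℝ
x +ℝ y = mkℝ (λ n → seq x n ℚ.+ seq y n) (+-isCauchy {seq x} {seq y} (cauchy x) (cauchy y))

_*ℝ_ : ℝ → ℝ → ℝ
x *ℝ y = mkℝ (λ n → seq x n ℚ.* seq y n) (*-isCauchy {seq x} {seq y} (cauchy x) (cauchy y))

_^ℝ_ : ℝ → ℕ → ℝ
x ^ℝ zero  = fromℕ 1
x ^ℝ suc n = x *ℝ x ^ℝ n

_ConvergesTo_ : (ℕ → ℝ) → ℝ → Set
s ConvergesTo y = ∀ ε → 0ℚ ℚ.< ε →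
  Eventually (λ n → s n ≤ℝ y +ℝ fromℚ ε × y ≤ℝ s n +ℝ fromℚ ε)

-- expSum x n = Σ_{k<n} xᵏ / k!
expSum : ℝ → ℕ → ℝ
expSum x zero    = fromℕ 0
expSum x (suc n) = expSum x n +ℝ fromℚ ((+ 1 ℚ./ (n !)) {{n !≢0}}) *ℝ x ^ℝ n

-- y = exp x
IsExp : ℝ → ℝ → Set
IsExp x y = expSum x ConvergesTo y

-- l = log x
IsLog : ℝ → ℝ → Set
IsLog x l = IsExp l x

-- s = √x
IsSqrt : ℝ → ℝ → Set
IsSqrt x s = fromℕ 0 ≤ℝ s × s *ℝ s ≈ℝ x

-- Σ_{a : P a} 1 ≤ b, the sum of non-negative terms over a possibly infinite
-- index set being the supremum of its finite partial sums.
CountAtMost : {A : Set} → (A → Set) → ℝ → Set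
CountAtMost {A} P b =
  (as : List A) → Unique as → All P as → fromℕ (length as) ≤ℝ b

PrimeFactorsDivide : ℕ → ℤ → Set
PrimeFactorsDivide d Δ = ∀ q → Prime q → q ℕ.∣ d → + q ℤ.∣ Δ

record InRange (Δ : ℤ) (X : ℝ) (t : ℕ × ℕ × ℕ × ℕ) : Set where
  r₁ = proj₁ t
  r₂ = proj₁ (proj₂ t)
  d₁ = proj₁ (proj₂ (proj₂ t))
  d₂ = proj₂ (proj₂ (proj₂ t))
  field
    r₁>0 : 0 ℕ.< r₁
    r₂>0 : 0 ℕ.< r₂
    d₁>0 : 0 ℕ.< d₁
    d₂>0 : 0 ℕ.< d₂
    r₁⊥Δ : gcd (+ r₁) Δ ≡ 1ℤ
    r₂⊥Δ : gcd (+ r₂) Δ ≡ 1ℤ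
    d₁∣Δ^∞ : PrimeFactorsDivide d₁ Δ
    d₂∣Δ^∞ : PrimeFactorsDivide d₂ Δ
    lcm≤X : fromℕ (lcm (r₁ ℕ.^ 2 ℕ.* d₁) (r₂ ℕ.^ 2 ℕ.* d₂)) ≤ℝ X

{-# OPTIONS --safe #-}
module Submission where

-- Write r₁ = a g, r₂ = b g with (a , b) = 1 and d₁ = e h, d₂ = f h with (e , f) = 1.
-- Since the r are coprime to the d, [r₁² d₁ , r₂² d₂] = (g a b)² h e f.  The number of
-- (g , a , b) with g a b ≤ Y is at most Y L² when Y < 2ᴸ, by cutting a and b into dyadic
-- blocks; each of h , e , f ranges over numbers whose primes are at most |Δ| and costs a
-- constant factor, because Σ √(X / pⁱ) ≪ √X for each p.  This gives ≪ √X L², and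
-- L ≪ |log X| follows from exp (m/4) ≤ 2ᵐ, a consequence of the mean value inequality
-- exp (x + 1/4) - exp x ≤ exp (x + 1/4) / 4.

open import Defs
open import Data.Integer.Base as ℤ using (ℤ; 0ℤ; 1ℤ)
import Data.Integer.Properties as ℤ
open import Data.List.Base using (List; []; _∷_; length)
open import Data.List.Relation.Unary.All as All using (All; []; _∷_)
open import Data.List.Relation.Unary.Unique.Propositional using (Unique)
open import Data.Nat.Tactic.RingSolver using (solve-∀)
open import Data.Product.Base using (_×_; _,_; proj₁; proj₂; ∃-syntax; map₂)
open import Data.Sum.Base using (_⊎_; inj₁; inj₂; [_,_]′)
open import Function.Base using (_∘_; id)
open import Relation.Nullary using (¬_; yes; no; contradiction)
open import Relation.Binary.PropositionalEquality

-- All counts are kept proportional to the integer `Y` that stands for √X, with no additive term.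
-- For `Y` = 0 nothing is left to count, so the recursion over powers of p stops by itself and the
-- exponents that occur never have to be counted. The real number X enters only afterwards. The
-- order of Cauchy reals is not decidable, so ⌊X⌋ cannot be computed; it is replaced by a natural
-- number `M` that bounds every integer k ≤ X and exceeds X by at most 4. The logarithm is known
-- only through the convergence of the exponential partial sums, so X is compared with a power of 2
-- by bounding rational partial sums at |log X|. Additive losses (the 4 above, and the 3 in `L` = m
-- + 3) go into the constant: X ≥ 1 absorbs the first, and X ≥ 2, which keeps |log X| away from 0,
-- the second.

module Counting where

  open import Data.Nat.Base
  open import Data.Nat.Properties
  open import Data.Nat.Coprimality as Coprime using (Coprime; coprime-divisor; gcd≡1⇒coprime)
  open import Data.Nat.Divisibility
  open import Data.Nat.DivMod using (_/_; /-monoˡ-≤; m*n/n≡m; m/n*n≤m; m/n≤m)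
  open import Data.Nat.GCD using (gcd; gcd[m,n]∣m; gcd[m,n]∣n; gcd-greatest; gcd[m,n]≢0)
  open import Data.Nat.Induction using (<-rec)
  open import Data.Nat.LCM using (lcm; m∣lcm[m,n]; n∣lcm[m,n]; gcd*lcm)
  open import Data.Nat.ListAction using (product)
  open import Data.Nat.Primality
  open import Data.Nat.Primality.Factorisation using (factorise)
  import Data.Integer.GCD as ℤ
  open import Data.Empty using (⊥-elim)
  open import Data.Fin.Base using (Fin; zero; suc)
  open import Data.Fin.Properties using (injective⇒≤)
  open import Data.List.Base using (_++_; map; lookup; cartesianProduct; upTo)
  open import Data.List.Properties using (length-map; length-++; length-upTo)
  open import Data.List.Membership.Propositional using (_∈_)
  open import Data.List.Membership.Propositional.Properties
  open import Data.List.Relation.Unary.AllPairs using (_∷_)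
  open import Data.List.Relation.Unary.Any using (index)
  open import Data.List.Relation.Unary.Any.Properties using (lookup-index)
  open import Data.Unit.Base using (⊤; tt)

  -- Finite covers as upper bounds for cardinalities

  private
    variable
      A B : Set
      P Q R : A → Set
      m n : ℕ

  -- The list may have repetitions, so covers pass along surjections without any injectivity.
  Cover : {A : Set} → (A → Set) → ℕ → Set
  Cover P n = ∃[ xs ] (length xs ≤ n × (∀ {a} → P a → a ∈ xs))

  lookup-injective : {xs : List A} → Unique xs → ∀ {i j} → lookup xs i ≡ lookup xs j → i ≡ j
  lookup-injective (_ ∷ _)   {zero}  {zero}  _  = refl
  lookup-injective (x∉ ∷ _)  {zero}  {suc j} eq = contradiction eq (All.lookup x∉ (∈-lookup j))
  lookup-injective (x∉ ∷ _)  {suc i} {zero}  eq = contradiction (sym eq) (All.lookup x∉ (∈-lookup i))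
  lookup-injective (_ ∷ xs!) {suc i} {suc j} eq = cong suc (lookup-injective xs! eq)

  -- Pigeonhole: each entry is sent to a position of the cover that holds it, and two entries sent
  -- to the same position are equal.
  cover⇒length≤ : Cover P n → (as : List _) → Unique as → All P as → length as ≤ n
  cover⇒length≤ {n = n} (xs , len , complete) as as! Pas = ≤-trans (injective⇒≤ {f = position} injective) len
    where
    found : ∀ i → lookup as i ∈ xs
    found i = complete (All.lookup Pas (∈-lookup i))
    position : Fin (length as) → Fin (length xs)
    position i = index (found i)
    injective : ∀ {i j} → position i ≡ position j → i ≡ j
    injective {i} {j} eq = lookup-injective as! (begin
      lookup as i            ≡⟨ lookup-index (found i) ⟩
      lookup xs (position i) ≡⟨ cong (lookup xs) eq ⟩
      lookup xs (position j) ≡⟨ lookup-index (found j) ⟨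
      lookup as j            ∎)
      where open ≡-Reasoning

  cover-mono : m ≤ n → Cover P m → Cover P n
  cover-mono m≤n (xs , len , complete) = xs , ≤-trans len m≤n , complete

  cover-⊥ : (∀ {a} → ¬ P a) → Cover P n
  cover-⊥ empty = [] , z≤n , λ p → ⊥-elim (empty p)

  cover-image : (f : A → B) → (∀ {b} → Q b → ∃[ a ] (P a × f a ≡ b)) → Cover P n → Cover Q n
  cover-image f preimage (xs , len , complete) =
    map f xs , ≤-trans (≤-reflexive (length-map f xs)) len ,
    λ q → let a , p , fa≡b = preimage q in subst (_∈ map f xs) fa≡b (∈-map⁺ f (complete p))

  cover-⊆ : (∀ {a} → Q a → P a) → Cover P n → Cover Q n
  cover-⊆ Q⊆P = map₂ (map₂ (_∘ Q⊆P))

  cover-∪ : (∀ {a} → R a → P a ⊎ Q a) → Cover P m → Cover Q n → Cover R (m + n)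
  cover-∪ split (xs , len-xs , complete-xs) (ys , len-ys , complete-ys) =
    xs ++ ys , ≤-trans (≤-reflexive (length-++ xs)) (+-mono-≤ len-xs len-ys) ,
    [ ∈-++⁺ˡ ∘ complete-xs , ∈-++⁺ʳ xs ∘ complete-ys ]′ ∘ split

  length-cartesianProduct : (xs : List A) (ys : List B) →
    length (cartesianProduct xs ys) ≡ length xs * length ys
  length-cartesianProduct []       ys = refl
  length-cartesianProduct (x ∷ xs) ys =
    trans (length-++ (map (x ,_) ys)) (cong₂ _+_ (length-map (x ,_) ys) (length-cartesianProduct xs ys))

  cover-× : Cover P m → Cover Q n → Cover (λ (a , b) → P a × Q b) (m * n)
  cover-× (xs , len-xs , complete-xs) (ys , len-ys , complete-ys) =
    cartesianProduct xs ys ,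
    ≤-trans (≤-reflexive (length-cartesianProduct xs ys)) (*-mono-≤ len-xs len-ys) ,
    λ (p , q) → ∈-cartesianProduct⁺ (complete-xs p) (complete-ys q)

  cover-⋃ : {P : ℕ → A → Set} → ∀ L → (∀ j → j < L → Cover (P j) n) →
            Cover (λ a → ∃[ j ] (j < L × P j a)) (L * n)
  cover-⋃ zero    _     = cover-⊥ λ ()
  cover-⋃ {P = P} (suc L) cover = cover-∪ split (cover L ≤-refl) (cover-⋃ L λ j j<L → cover j (m<n⇒m<1+n j<L))
    where
    split : ∀ {a} → ∃[ j ] (j < suc L × P j a) → P L a ⊎ ∃[ j ] (j < L × P j a)
    split (j , j<1+L , p) with m≤n⇒m<n∨m≡n (s≤s⁻¹ j<1+L)
    ... | inj₁ j<L  = inj₂ (j , j<L , p)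
    ... | inj₂ refl = inj₁ p

  -- Products of positive integers up to Y, by dyadic blocks

  -- `L` caps all the `Y` at once, so `K` may depend on the number of dyadic blocks and stay fixed
  -- while `Y` shrinks. Positivity of `w a` keeps out the infinitely many tuples with a zero
  -- coordinate.
  LinearBound : {A : Set} → (A → ℕ) → ℕ → ℕ → Set
  LinearBound w L K = ∀ Y → Y < 2 ^ L → Cover (λ a → 0 < w a × w a ≤ Y) (K * Y)

  linearBound-id : ∀ L → LinearBound id L 1
  linearBound-id L Y _ =
    cover-mono (≤-reflexive (sym (*-identityˡ Y)))
      (cover-image suc (λ { {suc b} (_ , b<Y) → b , b<Y , refl })
        (upTo Y , ≤-reflexive (length-upTo Y) , ∈-upTo⁺))

  0<*⇒0<ˡ : ∀ m n → 0 < m * n → 0 < m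
  0<*⇒0<ˡ (suc m) n _ = z<s

  0<*⇒0<ʳ : ∀ m n → 0 < m * n → 0 < n
  0<*⇒0<ʳ m n 0<mn = 0<*⇒0<ˡ n m (subst (0 <_) (*-comm m n) 0<mn)

  0<m*n : 0 < m → 0 < n → 0 < m * n
  0<m*n = *-mono-<

  dyadic : ∀ L → 0 < n → n < 2 ^ L → ∃[ j ] (j < L × 2 ^ j ≤ n × n < 2 ^ suc j)
  dyadic {suc n} zero    _   (s≤s ())
  dyadic {n}     (suc L) 0<n n<2^ with 2 ^ L ≤? n
  ... | yes 2^L≤n = L , ≤-refl , 2^L≤n , n<2^
  ... | no  2^L≰n = let j , j<L , bounds = dyadic L 0<n (≰⇒> 2^L≰n) in j , m<n⇒m<1+n j<L , bounds

  cover-dyadic : ∀ j → Cover (λ n → 2 ^ j ≤ n × n < 2 ^ suc j) (2 ^ j)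
  cover-dyadic j = cover-image (2 ^ j +_) preimage (upTo (2 ^ j) , ≤-reflexive (length-upTo (2 ^ j)) , ∈-upTo⁺)
    where
    preimage : ∀ {n} → 2 ^ j ≤ n × n < 2 ^ suc j → ∃[ i ] (i < 2 ^ j × 2 ^ j + i ≡ n)
    preimage {n} (lo , hi) = n ∸ 2 ^ j ,
      +-cancelˡ-< (2 ^ j) _ _ (begin-strict
        2 ^ j + (n ∸ 2 ^ j)   ≡⟨ m+[n∸m]≡n lo ⟩
        n                     <⟨ hi ⟩
        2 ^ j + (2 ^ j + 0)   ≡⟨ cong (2 ^ j +_) (+-identityʳ (2 ^ j)) ⟩
        2 ^ j + 2 ^ j         ∎) ,
      m+[n∸m]≡n lo
      where open ≤-Reasoning

  -- For n in [2ʲ , 2ʲ⁺¹) there remain w a ≤ Y / 2ʲ, so each of the L dyadic blocks contributes K Y.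
  linearBound-* : ∀ {w : A → ℕ} L K → LinearBound w L K →
                  LinearBound (λ (a , n) → w a * n) L (L * K)
  linearBound-* {w = w} L K bound Y Y<2^L =
    cover-mono (≤-reflexive (sym (*-assoc L K Y))) (cover-⊆ split (cover-⋃ L block))
    where
    open ≤-Reasoning
    half^ : ℕ → ℕ
    half^ j = (Y / 2 ^ j) {{m^n≢0 2 j}}
    ≤half^ : ∀ {x} j → x * 2 ^ j ≤ Y → x ≤ half^ j
    ≤half^ {x} j x2^j≤Y = begin
      x                               ≡⟨ m*n/n≡m x (2 ^ j) ⟨
      x * 2 ^ j / 2 ^ j               ≤⟨ /-monoˡ-≤ (2 ^ j) x2^j≤Y ⟩
      Y / 2 ^ j                       ∎
      where
      instance
        2^j≢0 : NonZero (2 ^ j)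
        2^j≢0 = m^n≢0 2 j
    block : ∀ j → j < L → Cover (λ (a , n) → (0 < w a × w a ≤ half^ j) × (2 ^ j ≤ n × n < 2 ^ suc j)) (K * Y)
    block j _ = cover-mono
      (begin
        K * half^ j * 2 ^ j     ≡⟨ *-assoc K (half^ j) (2 ^ j) ⟩
        K * (half^ j * 2 ^ j)   ≤⟨ *-monoʳ-≤ K (m/n*n≤m Y (2 ^ j) {{m^n≢0 2 j}}) ⟩
        K * Y                   ∎)
      (cover-× (bound (half^ j) (≤-<-trans (m/n≤m Y (2 ^ j) {{m^n≢0 2 j}}) Y<2^L)) (cover-dyadic j))
    split : ∀ {(a , n) : _ × ℕ} → 0 < w a * n × w a * n ≤ Y →
            ∃[ j ] (j < L × (0 < w a × w a ≤ half^ j) × (2 ^ j ≤ n × n < 2 ^ suc j))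
    split {a , n} (0<wn , wn≤Y) =
      let 0<w = 0<*⇒0<ˡ (w a) n 0<wn
          n≤Y = ≤-trans (m≤n*m n (w a) {{>-nonZero 0<w}}) wn≤Y
          j , j<L , lo , hi = dyadic L (0<*⇒0<ʳ (w a) n 0<wn) (≤-<-trans n≤Y Y<2^L)
      in j , j<L , (0<w , ≤half^ j (≤-trans (*-monoʳ-≤ (w a) lo) wn≤Y)) , lo , hi

  -- Smooth factors under a square-root bound

  -- The condition says ⌊√(w a)⌋ ≤ `Y`, so `Y` is an integer form of √X. At `Y` = 0 it cannot hold,
  -- in agreement with the bound `K * 0`.
  SqrtBound : {A : Set} → (A → Set) → (A → ℕ) → ℕ → ℕ → Set
  SqrtBound P w L K = ∀ Y → Y < 2 ^ L → Cover (λ a → P a × 0 < w a × w a < suc Y * suc Y) (K * Y)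

  linearBound⇒sqrtBound : ∀ {w : A → ℕ} L K → LinearBound w L K →
                          SqrtBound (λ _ → ⊤) (λ a → w a * w a) L K
  linearBound⇒sqrtBound {w = w} L K bound Y Y<2^L = cover-⊆
    (λ {a} (_ , 0<ww , ww<) → 0<*⇒0<ˡ (w a) (w a) 0<ww ,
       ≮⇒≥ λ Y<w → <⇒≱ ww< (*-mono-≤ Y<w Y<w))
    (bound Y Y<2^L)

  -- The offset makes 1 the only 0-smooth number.
  Smooth : ℕ → ℕ → Set
  Smooth k d = ∀ q → Prime q → q ∣ d → q < 2 + k

  prime≥2 : ∀ {p} → Prime p → 2 ≤ p
  prime≥2 {p} pr = nonTrivial⇒n>1 p {{prime⇒nonTrivial pr}}

  primeDivisor : ∀ n → 0 < n → n ≢ 1 → ∃[ p ] (Prime p × p ∣ n)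
  primeDivisor n 0<n n≢1 with factorise n {{>-nonZero 0<n}}
  ... | record { factors = [] ; isFactorisation = eq } = contradiction eq n≢1
  ... | record { factors = p ∷ ps ; isFactorisation = eq ; factorsPrime = pr ∷ _ } =
    p , pr , divides (product ps) (trans eq (*-comm p (product ps)))

  smooth0⇒≡1 : ∀ {d} → 0 < d → Smooth 0 d → d ≡ 1
  smooth0⇒≡1 {d} 0<d smooth with d ≟ 1
  ... | yes d≡1 = d≡1
  ... | no  d≢1 with p , pr , p∣d ← primeDivisor d 0<d d≢1 = contradiction (smooth p pr p∣d) (≤⇒≯ (prime≥2 pr))

  smooth-∣ : ∀ {k c d} → c ∣ d → Smooth k d → Smooth k c
  smooth-∣ c∣d smooth q pr q∣c = smooth q pr (∣-trans q∣c c∣d)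

  smooth-∤ : ∀ {k d} → ¬ (2 + k ∣ d) → Smooth (suc k) d → Smooth k d
  smooth-∤ p∤d smooth q pr q∣d = ≤∧≢⇒< (s≤s⁻¹ (smooth q pr q∣d)) λ { refl → p∤d q∣d }

  -- Peeling off two factors p at a time halves the square root, also after rounding down.
  square-halve : ∀ {p x} Y → 2 ≤ p → p * (p * x) < suc Y * suc Y → x < suc ⌊ Y /2⌋ * suc ⌊ Y /2⌋
  square-halve {p} {x} Y 2≤p ppx< = ≰⇒> λ hh≤x → <⇒≱ ppx< (begin
    suc Y * suc Y              ≤⟨ *-mono-≤ 1+Y≤2h 1+Y≤2h ⟩
    (2 * h) * (2 * h)          ≡⟨ rearrange h ⟩
    2 * (2 * (h * h))          ≤⟨ *-mono-≤ 2≤p (*-mono-≤ 2≤p hh≤x) ⟩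
    p * (p * x)                ∎)
    where
    open ≤-Reasoning
    h = suc ⌊ Y /2⌋
    rearrange : ∀ h → (2 * h) * (2 * h) ≡ 2 * (2 * (h * h))
    rearrange = solve-∀
    double : ∀ u → suc (u + suc u) ≡ 2 * suc u
    double = solve-∀
    1+Y≤2h : suc Y ≤ 2 * h
    1+Y≤2h = begin
      suc Y                        ≡⟨ cong suc (⌊n/2⌋+⌈n/2⌉≡n Y) ⟨
      suc (⌊ Y /2⌋ + ⌈ Y /2⌉)      ≤⟨ s≤s (+-monoʳ-≤ ⌊ Y /2⌋ (⌊n/2⌋-mono (n≤1+n (suc Y)))) ⟩
      suc (⌊ Y /2⌋ + suc ⌊ Y /2⌋)  ≡⟨ double ⌊ Y /2⌋ ⟩
      2 * h                        ∎

  -- With p = 2 + k (prime or not), the cases p ∤ d, p ∥ d and p² ∣ d contribute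
  -- K′ Y, K′ Y and, by induction on Y, at most 4 K′ ⌊Y/2⌋ ≤ 2 K′ Y.
  sqrtBound-*smooth : ∀ {P : A → Set} {w : A → ℕ} L K k → SqrtBound P w L K →
    SqrtBound {A × ℕ} (λ (a , d) → P a × Smooth k d) (λ (a , d) → w a * d) L (4 ^ k * K)
  sqrtBound-*smooth {P = P} {w} L K zero bound Y Y<2^L =
    cover-mono (≤-reflexive (cong (_* Y) (sym (*-identityˡ K))))
      (cover-image (_, 1) preimage (bound Y Y<2^L))
    where
    preimage : ∀ {(a , d) : _ × ℕ} → (P a × Smooth 0 d) × 0 < w a * d × w a * d < suc Y * suc Y →
               ∃[ b ] ((P b × 0 < w b × w b < suc Y * suc Y) × (b , 1) ≡ (a , d))
    preimage {a , d} ((p , smooth) , 0<wd , wd<)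
      with refl ← smooth0⇒≡1 (0<*⇒0<ʳ (w a) d 0<wd) smooth =
      a , (p , subst (λ x → 0 < x × x < suc Y * suc Y) (*-identityʳ (w a)) (0<wd , wd<)) , refl
  sqrtBound-*smooth {A = A} {P = P} {w} L K (suc k) bound = <-rec _ step
    where
    open ≤-Reasoning
    p = 2 + k
    K′ = 4 ^ k * K
    Below : ℕ → ℕ → A × ℕ → Set
    Below j Y (a , d) = (P a × Smooth j d) × 0 < w a * d × w a * d < suc Y * suc Y
    Goal : ℕ → Set
    Goal Y = Y < 2 ^ L → Cover (Below (suc k) Y) (4 ^ suc k * K * Y)

    scale : A × ℕ → A × ℕ
    scale (a , d) = a , d * p

    -- `One` keeps the bound `Y` although a factor p is removed: dividing by √p would leave the
    -- integers, and the loss is harmless because p ∥ d arises only once for each d.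
    One Two : ℕ → A × ℕ → Set
    One Y t = ∃[ s ] (Below k Y s × scale s ≡ t)
    Two Y t = ∃[ s ] (Below (suc k) ⌊ Y /2⌋ s × scale (scale s) ≡ t)

    0<w*-∣ : ∀ a d e → 0 < w a * (d * e) → 0 < w a * d
    0<w*-∣ a d e pos = 0<m*n (0<*⇒0<ˡ (w a) (d * e) pos) (0<*⇒0<ˡ d e (0<*⇒0<ʳ (w a) (d * e) pos))

    split : ∀ Y {t} → Below (suc k) Y t → Below k Y t ⊎ (One Y t ⊎ Two Y t)
    split Y {a , d} ((Pa , smooth) , 0<wd , wd<) with p ∣? d
    ... | no  p∤d = inj₁ ((Pa , smooth-∤ p∤d smooth) , 0<wd , wd<)
    ... | yes (divides-refl d′) with p ∣? d′
    ... | no  p∤d′ = inj₂ (inj₁ ((a , d′) ,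
            ((Pa , smooth-∤ p∤d′ (smooth-∣ (m∣m*n p) smooth)) , 0<w*-∣ a d′ p 0<wd ,
              ≤-<-trans (*-monoʳ-≤ (w a) (m≤m*n d′ p)) wd<) , refl))
    ... | yes (divides-refl d″) = inj₂ (inj₂ ((a , d″) ,
            ((Pa , smooth-∣ (∣-trans (m∣m*n p) (m∣m*n p)) smooth) , 0<w*-∣ a d″ p (0<w*-∣ a (d″ * p) p 0<wd) ,
              square-halve {p} Y (s≤s (s≤s z≤n)) (subst (_< suc Y * suc Y) (rearrange (w a) d″ p) wd<)) , refl))
      where
      rearrange : ∀ w d p → w * (d * p * p) ≡ p * (p * (w * d))
      rearrange = solve-∀

    step : ∀ Y → (∀ {Z} → Z < Y → Goal Z) → Goal Y
    -- No positive number is below 1; this is where the chain of halvings of `Y` ends.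
    step zero rec _ = cover-⊥ λ (_ , 0<x , x<1) → <⇒≱ x<1 0<x
    step (suc Z) rec Y<2^L = cover-mono
      (begin
        K′ * Y + (K′ * Y + 4 ^ suc k * K * h)  ≡⟨ cong (λ x → K′ * Y + (K′ * Y + x)) (regroup (4 ^ k) K h) ⟩
        K′ * Y + (K′ * Y + K′ * (2 * (2 * h))) ≤⟨ +-monoʳ-≤ (K′ * Y) (+-monoʳ-≤ (K′ * Y) (*-monoʳ-≤ K′ (*-monoʳ-≤ 2 2h≤Y))) ⟩
        K′ * Y + (K′ * Y + K′ * (2 * Y))       ≡⟨ collect (4 ^ k) K Y ⟩
        4 ^ suc k * K * Y                      ∎)
      (cover-∪ (split Y) cover-k
        (cover-∪ id (cover-image scale id cover-k)
                    (cover-image (scale ∘ scale) id (rec (⌊n/2⌋<n Z) (≤-<-trans (⌊n/2⌋≤n Y) Y<2^L)))))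
      where
      Y = suc Z
      h = ⌊ Y /2⌋
      cover-k : Cover (Below k Y) (K′ * Y)
      cover-k = sqrtBound-*smooth {P = P} {w} L K k bound Y Y<2^L
      2h≤Y : 2 * h ≤ Y
      2h≤Y = begin
        h + (h + 0)      ≡⟨ cong (h +_) (+-identityʳ h) ⟩
        h + h            ≤⟨ +-monoʳ-≤ h (⌊n/2⌋≤⌈n/2⌉ Y) ⟩
        h + ⌈ Y /2⌉      ≡⟨ ⌊n/2⌋+⌈n/2⌉≡n Y ⟩
        Y                ∎
      regroup : ∀ f K h → 4 * f * K * h ≡ f * K * (2 * (2 * h))
      regroup = solve-∀
      collect : ∀ f K Y → f * K * Y + (f * K * Y + f * K * (2 * Y)) ≡ 4 * f * K * Y
      collect = solve-∀

  -- Coprimality and splitting off the gcd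

  coprime-∣ : ∀ {m m′ n n′} → m ∣ m′ → n ∣ n′ → Coprime m′ n′ → Coprime m n
  coprime-∣ m∣ n∣ coprime (i∣m , i∣n) = coprime (∣-trans i∣m m∣ , ∣-trans i∣n n∣)

  coprime-*ʳ : ∀ {m n o} → Coprime m n → Coprime m o → Coprime m (n * o)
  coprime-*ʳ m⊥n m⊥o (i∣m , i∣no) =
    m⊥o (i∣m , coprime-divisor (coprime-∣ i∣m ∣-refl m⊥n) i∣no)

  coprime-*ˡ : ∀ {m n o} → Coprime m o → Coprime n o → Coprime (m * n) o
  coprime-*ˡ m⊥o n⊥o = Coprime.sym (coprime-*ʳ (Coprime.sym m⊥o) (Coprime.sym n⊥o))

  coprime-square : ∀ {m n} → Coprime m n → Coprime (m * m) (n * n)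
  coprime-square m⊥n = coprime-*ˡ (coprime-*ʳ m⊥n m⊥n) (coprime-*ʳ m⊥n m⊥n)

  coprime⇒*∣ : ∀ {m n o} → Coprime m n → m ∣ o → n ∣ o → m * n ∣ o
  coprime⇒*∣ {m} {n} m⊥n (divides-refl q) n∣qm =
    subst (_∣ q * m) (*-comm n m)
      (*-monoˡ-∣ m (coprime-divisor (Coprime.sym m⊥n) (subst (n ∣_) (*-comm q m) n∣qm)))

  -- For coprime m and n the least common multiple of m g and n g is m n g. Writing o = q m g and
  -- cancelling g reduces this to m n ∣ q m.
  coprime⇒*g∣ : ∀ {m n o} g → 0 < g → Coprime m n → m * g ∣ o → n * g ∣ o → m * n * g ∣ o
  coprime⇒*g∣ {m} {n} g 0<g m⊥n (divides-refl q) ng∣ =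
    subst (m * n * g ∣_) (*-assoc q m g)
      (*-monoˡ-∣ g (coprime⇒*∣ m⊥n (n∣m*n q)
        (*-cancelʳ-∣ g {{>-nonZero 0<g}} (subst (n * g ∣_) (sym (*-assoc q m g)) ng∣))))

  record GcdSplit (m n : ℕ) : Set where
    constructor gcdSplit
    field
      {g a b}  : ℕ
      m≡ag     : m ≡ a * g
      n≡bg     : n ≡ b * g
      a⊥b      : Coprime a b

  splitGcd : ∀ m n → 0 < m → GcdSplit m n
  splitGcd m n 0<m with gcd[m,n]∣m m n | gcd[m,n]∣n m n
  ... | divides a m≡ag | divides b n≡bg = gcdSplit m≡ag n≡bg a⊥b
    where
    g = gcd m n
    instance
      g≢0 : NonZero g
      g≢0 = ≢-nonZero (gcd[m,n]≢0 m n (inj₁ (m<n⇒n≢0 0<m)))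
    a⊥b : Coprime a b
    a⊥b {i} (i∣a , i∣b) = ∣1⇒≡1 (*-cancelʳ-∣ g (subst (i * g ∣_) (sym (*-identityˡ g))
      (gcd-greatest (subst (i * g ∣_) (sym m≡ag) (*-monoˡ-∣ g i∣a))
                    (subst (i * g ∣_) (sym n≡bg) (*-monoˡ-∣ g i∣b)))))

  -- Only primes dividing d are known to divide Δ, so a common divisor i ≠ 1 is first replaced by
  -- one of its prime factors, which then divides both r and Δ.
  coprime-Δ : ∀ Δ {r d} → 0 < d → ℤ.gcd (ℤ.+ r) Δ ≡ 1ℤ → PrimeFactorsDivide d Δ → Coprime r d
  coprime-Δ Δ {r} {d} 0<d r⊥Δ d∣Δ^∞ {i} (i∣r , i∣d) with i ≟ 1
  ... | yes i≡1 = i≡1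
  ... | no  i≢1 = contradiction (subst Prime q≡1 q-prime) ¬prime[1]
    where
    i>0 : 0 < i
    i>0 = n≢0⇒n>0 λ { refl → m<n⇒n≢0 0<d (0∣⇒≡0 i∣d) }
    q = proj₁ (primeDivisor i i>0 i≢1)
    q-prime = proj₁ (proj₂ (primeDivisor i i>0 i≢1))
    q∣i = proj₂ (proj₂ (primeDivisor i i>0 i≢1))
    q≡1 : q ≡ 1
    q≡1 = gcd≡1⇒coprime (ℤ.+-injective r⊥Δ) (∣-trans q∣i i∣r , d∣Δ^∞ q q-prime (∣-trans q∣i i∣d))

  -- The primes dividing Δ are enlarged to all primes up to |Δ|. This only worsens the constant, and
  -- it lets the count proceed by induction on k instead of along a factorisation of Δ.
  smooth-Δ : ∀ {Δ d} → Δ ≢ 0ℤ → PrimeFactorsDivide d Δ → Smooth ℤ.∣ Δ ∣ d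
  smooth-Δ Δ≢0 d∣Δ^∞ q pr q∣d =
    m<n⇒m<1+n (s≤s (∣⇒≤ {{≢-nonZero (Δ≢0 ∘ ℤ.∣i∣≡0⇒i≡0)}} (d∣Δ^∞ q pr q∣d)))

  lcm>0 : ∀ {m n} → 0 < m → 0 < n → 0 < lcm m n
  lcm>0 {m} {n} 0<m 0<n = 0<*⇒0<ʳ (gcd m n) (lcm m n) (subst (0 <_) (sym (gcd*lcm m n)) (0<m*n 0<m 0<n))

  lcmOf : ℕ × ℕ × ℕ × ℕ → ℕ
  lcmOf (r₁ , r₂ , d₁ , d₂) = lcm (r₁ ^ 2 * d₁) (r₂ ^ 2 * d₂)

  lcmOf>0 : ∀ {Δ X t} → InRange Δ X t → 0 < lcmOf t
  lcmOf>0 {t = r₁ , r₂ , d₁ , d₂} ir = lcm>0 (0<m*n (square>0 r₁>0) d₁>0) (0<m*n (square>0 r₂>0) d₂>0)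
    where
    open InRange ir
    square>0 : ∀ {r} → 0 < r → 0 < r ^ 2
    square>0 {suc r} _ = z<s

  -- Parametrising the quadruples by sextuples

  -- Nested to the left because each use of `linearBound-*` or `sqrtBound-*smooth` appends one
  -- coordinate.
  Sextuple : Set
  Sextuple = ((((ℕ × ℕ) × ℕ) × ℕ) × ℕ) × ℕ

  rPart : (ℕ × ℕ) × ℕ → ℕ
  rPart ((g , a) , b) = g * a * b

  weight : Sextuple → ℕ
  weight (((t , h) , e) , f) = rPart t * rPart t * h * e * f

  quadruple : Sextuple → ℕ × ℕ × ℕ × ℕ
  quadruple (((((g , a) , b) , h) , e) , f) = a * g , b * g , e * h , f * h

  AllSmooth : ℕ → Sextuple → Set
  AllSmooth k (((_ , h) , e) , f) = ((⊤ × Smooth k h) × Smooth k e) × Smooth k f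

  sextuples-bound : ∀ k L → SqrtBound (AllSmooth k) weight L (4 ^ k * (4 ^ k * (4 ^ k * (L * (L * 1)))))
  sextuples-bound k L =
    sqrtBound-*smooth L _ k (sqrtBound-*smooth L _ k (sqrtBound-*smooth L _ k
      (linearBound⇒sqrtBound L (L * (L * 1)) (linearBound-* L (L * 1) (linearBound-* L 1 (linearBound-id L))))))

  -- The weight of the sextuple is in fact [r₁ , r₂]² [d₁ , d₂] = [r₁² d₁ , r₂² d₂].
  sextuple-of : ∀ {Δ X t} → Δ ≢ 0ℤ → InRange Δ X t →
    ∃[ s ] (AllSmooth ℤ.∣ Δ ∣ s × (0 < weight s × weight s ≤ lcmOf t) × quadruple s ≡ t)
  sextuple-of {Δ} {t = r₁ , r₂ , d₁ , d₂} Δ≢0 ir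
    with splitGcd r₁ r₂ (InRange.r₁>0 ir) | splitGcd d₁ d₂ (InRange.d₁>0 ir)
  ... | gcdSplit {g} {a} {b} refl refl a⊥b | gcdSplit {h} {e} {f} refl refl e⊥f =
    (((((g , a) , b) , h) , e) , f) ,
    (((tt , smooth (n∣m*n e) d₁∣Δ^∞) , smooth (m∣m*n h) d₁∣Δ^∞) , smooth (m∣m*n h) d₂∣Δ^∞) ,
    (>-nonZero⁻¹ W {{≢-nonZero W≢0}} , ∣⇒≤ {{>-nonZero M>0}} W∣M) , refl
    where
    open InRange ir using (r₁>0; r₂>0; d₁>0; d₂>0; r₁⊥Δ; r₂⊥Δ; d₁∣Δ^∞; d₂∣Δ^∞)
    W = weight (((((g , a) , b) , h) , e) , f)
    M = lcmOf (r₁ , r₂ , d₁ , d₂)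
    M>0 : 0 < M
    M>0 = lcmOf>0 ir
    smooth : ∀ {c d} → c ∣ d → PrimeFactorsDivide d Δ → Smooth ℤ.∣ Δ ∣ c
    smooth c∣d d∣Δ^∞ = smooth-∣ c∣d (smooth-Δ Δ≢0 d∣Δ^∞)
    g>0 : 0 < g
    g>0 = 0<*⇒0<ʳ a g r₁>0
    r²≡ : ∀ a g → a * a * (g * g) ≡ a * g * (a * g * 1)
    r²≡ = solve-∀
    r₁²∣M : a * a * (g * g) ∣ M
    r₁²∣M = subst (_∣ M) (sym (r²≡ a g)) (∣-trans (m∣m*n d₁) (m∣lcm[m,n] (r₁ ^ 2 * d₁) (r₂ ^ 2 * d₂)))
    r₂²∣M : b * b * (g * g) ∣ M
    r₂²∣M = subst (_∣ M) (sym (r²≡ b g)) (∣-trans (m∣m*n d₂) (n∣lcm[m,n] (r₁ ^ 2 * d₁) (r₂ ^ 2 * d₂)))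
    [r]²∣M : a * a * (b * b) * (g * g) ∣ M
    [r]²∣M = coprime⇒*g∣ (g * g) (0<m*n g>0 g>0) (coprime-square a⊥b) r₁²∣M r₂²∣M
    [d]∣M : e * f * h ∣ M
    [d]∣M = coprime⇒*g∣ h (0<*⇒0<ʳ e h d₁>0) e⊥f
      (∣-trans (n∣m*n (r₁ ^ 2)) (m∣lcm[m,n] (r₁ ^ 2 * d₁) (r₂ ^ 2 * d₂)))
      (∣-trans (n∣m*n (r₂ ^ 2)) (n∣lcm[m,n] (r₁ ^ 2 * d₁) (r₂ ^ 2 * d₂)))
    r⊥d : Coprime (r₁ * r₂) (d₁ * d₂)
    r⊥d = coprime-*ˡ {r₁} {r₂}
      (coprime-*ʳ {_} {d₁} {d₂} (coprime-Δ Δ {_} {d₁} d₁>0 r₁⊥Δ d₁∣Δ^∞) (coprime-Δ Δ {_} {d₂} d₂>0 r₁⊥Δ d₂∣Δ^∞))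
      (coprime-*ʳ {_} {d₁} {d₂} (coprime-Δ Δ {_} {d₁} d₁>0 r₂⊥Δ d₁∣Δ^∞) (coprime-Δ Δ {_} {d₂} d₂>0 r₂⊥Δ d₂∣Δ^∞))
    [r]²⊥[d] : Coprime (a * a * (b * b) * (g * g)) (e * f * h)
    -- (r₁ r₂)² is g² times [r₁ , r₂]², and d₁ d₂ is h times [d₁ , d₂]; coprimality descends to
    -- these divisors.
    [r]²⊥[d] = coprime-∣ (divides (g * g) (eq₁ a b g)) (divides h (eq₂ e f h)) (coprime-*ˡ r⊥d r⊥d)
      where
      eq₁ : ∀ a b g → a * g * (b * g) * (a * g * (b * g)) ≡ g * g * (a * a * (b * b) * (g * g))
      eq₁ = solve-∀
      eq₂ : ∀ e f h → e * h * (f * h) ≡ h * (e * f * h)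
      eq₂ = solve-∀
    W∣M : W ∣ M
    W∣M = subst (_∣ M) (eq a b g e f h) (coprime⇒*∣ [r]²⊥[d] [r]²∣M [d]∣M)
      where
      eq : ∀ a b g e f h → a * a * (b * b) * (g * g) * (e * f * h) ≡ g * a * b * (g * a * b) * h * e * f
      eq = solve-∀
    W≢0 : W ≢ 0
    W≢0 W≡0 = m<n⇒n≢0 M>0 (0∣⇒≡0 (subst (_∣ M) W≡0 W∣M))

  countBound : ℕ → ℕ → ℕ → ℕ
  countBound C L Y = C * (C * (C * (L * (L * 1)))) * Y

  -- The condition on `lcmOf t` is the natural-number form of the bound by X; `count-large` derives
  -- it from the real inequality in `InRange`.
  inRange-cover : ∀ {Δ X} → Δ ≢ 0ℤ → ∀ {L Y} → Y < 2 ^ L →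
    Cover (λ t → InRange Δ X t × lcmOf t < suc Y * suc Y) (countBound (4 ^ ℤ.∣ Δ ∣) L Y)
  inRange-cover {Δ} Δ≢0 {L} {Y} Y<2^L = cover-image quadruple
    (λ (ir , lcm<) → let s , smooth , (0<w , w≤lcm) , eq = sextuple-of Δ≢0 ir
                     in s , (smooth , 0<w , ≤-<-trans w≤lcm lcm<) , eq)
    (sextuples-bound ℤ.∣ Δ ∣ L Y Y<2^L)

open Counting

open import Data.Nat.Base as ℕ using (ℕ; zero; suc; _!)
import Data.Nat.Properties as ℕ
import Data.Nat.Coprimality as Coprime
open import Data.Integer.Base using (+_)
open import Data.Rational.Base
open import Data.Rational.Properties
import Data.Rational.Unnormalised.Base as ℚᵘ
import Data.Rational.Unnormalised.Properties as ℚᵘ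
open import Data.Rational.Solver
open +-*-Solver using (solve; _:+_; _:*_; _:=_; con; _:-_; :-_)
open import Relation.Nullary.Decidable using (from-yes; from-no)

-- Naturals as rationals, and rational inequalities

ι : ℕ → ℚ
ι n = + n / 1

-- `+ n / 1` is normalised through a gcd and is stuck for variable n; in the explicit form sums,
-- products and comparisons compute.
ι≡mkℚ : ∀ n → ι n ≡ mkℚ (+ n) 0 (Coprime.sym (Coprime.1-coprimeTo n))
ι≡mkℚ n = ↥p/↧p≡p (mkℚ (+ n) 0 (Coprime.sym (Coprime.1-coprimeTo n)))

ι-+ : ∀ m n → ι (m ℕ.+ n) ≡ ι m + ι n
ι-+ m n = trans (cong (_/ 1) (sym (cong₂ ℤ._+_ (ℤ.*-identityʳ (+ m)) (ℤ.*-identityʳ (+ n)))))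
  (sym (cong₂ _+_ (ι≡mkℚ m) (ι≡mkℚ n)))

ι-* : ∀ m n → ι (m ℕ.* n) ≡ ι m * ι n
ι-* m n = trans (cong (_/ 1) (ℤ.pos-* m n)) (sym (cong₂ _*_ (ι≡mkℚ m) (ι≡mkℚ n)))

ι-mono-≤ : ∀ {m n} → m ℕ.≤ n → ι m ≤ ι n
ι-mono-≤ {m} {n} m≤n = subst₂ _≤_ (sym (ι≡mkℚ m)) (sym (ι≡mkℚ n))
  (*≤* (ℤ.*-monoʳ-≤-nonNeg (+ 1) (ℤ.+≤+ m≤n)))

ι-cancel-≤ : ∀ {m n} → ι m ≤ ι n → m ℕ.≤ n
ι-cancel-≤ {m} {n} ιm≤ιn with subst₂ _≤_ (ι≡mkℚ m) (ι≡mkℚ n) ιm≤ιn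
... | *≤* le = ℤ.drop‿+≤+ (subst₂ ℤ._≤_ (ℤ.*-identityʳ (+ m)) (ℤ.*-identityʳ (+ n)) le)

0≤ι : ∀ n → 0ℚ ≤ ι n
0≤ι n = ι-mono-≤ {0} {n} ℕ.z≤n

[1/n]*n≡1 : ∀ n .{{_ : ℕ.NonZero n}} → (+ 1 / n) * ι n ≡ 1ℚ
[1/n]*n≡1 n@(suc m) = toℚᵘ-injective (begin
  toℚᵘ ((+ 1 / n) * ι n)             ≈⟨ toℚᵘ-homo-* (+ 1 / n) (ι n) ⟩
  toℚᵘ (+ 1 / n) ℚᵘ.* toℚᵘ (ι n)     ≈⟨ ℚᵘ.*-cong (toℚᵘ-fromℚᵘ (ℚᵘ.mkℚᵘ (+ 1) m)) (toℚᵘ-fromℚᵘ (ℚᵘ.mkℚᵘ (+ n) 0)) ⟩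
  ℚᵘ.mkℚᵘ (+ 1) m ℚᵘ.* ℚᵘ.mkℚᵘ (+ n) 0 ≈⟨ ℚᵘ.*≡* (cong (λ k → + k) (numerators m)) ⟩
  ℚᵘ.1ℚᵘ                             ∎)
  where
  open ℚᵘ.≃-Reasoning
  numerators : ∀ m → (suc m ℕ.+ 0) ℕ.* 1 ≡ suc m ℕ.* 1 ℕ.+ 0
  numerators = solve-∀

*-mono-≤ : ∀ {p q r s} → 0ℚ ≤ q → 0ℚ ≤ r → p ≤ q → r ≤ s → p * r ≤ q * s
*-mono-≤ {p} {q} {r} {s} 0≤q 0≤r p≤q r≤s = ≤-trans
  (*-monoʳ-≤-nonNeg r {{nonNegative 0≤r}} p≤q)
  (*-monoˡ-≤-nonNeg q {{nonNegative 0≤q}} r≤s)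

*-nonNeg : ∀ {p q} → 0ℚ ≤ p → 0ℚ ≤ q → 0ℚ ≤ p * q
*-nonNeg {p} {q} 0≤p 0≤q = nonNegative⁻¹ (p * q) {{nonNeg*nonNeg⇒nonNeg p {{nonNegative 0≤p}} q {{nonNegative 0≤q}}}}

+-nonNeg : ∀ {p q} → 0ℚ ≤ p → 0ℚ ≤ q → 0ℚ ≤ p + q
+-nonNeg = +-mono-≤

+-cancelʳ-≤ : ∀ {p q} r → p + r ≤ q + r → p ≤ q
+-cancelʳ-≤ {p} {q} r le = subst₂ _≤_ (cancel p r) (cancel q r) (+-monoˡ-≤ (- r) le)
  where
  cancel : ∀ p r → p + r - r ≡ p
  cancel = solve 2 (λ p r → p :+ r :- r := p) refl

-- The equation says v - u = b - a.
≤-linear : ∀ {a b u v} → a ≤ b → v + a ≡ u + b → u ≤ v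
≤-linear {a} {b} {u} {v} a≤b eq = +-cancelʳ-≤ b (subst (_≤ v + b) eq (+-monoʳ-≤ v a≤b))

-- Partial sums of the exponential series over the rationals

¼ : ℚ
¼ = + 1 / 4

-- Copies the recursion of `_^ℝ_`, as `expSumℚ` copies that of `expSum`, so that taking the n-th
-- approximation commutes with both.
pow : ℚ → ℕ → ℚ
pow x zero    = ι 1
pow x (suc k) = x * pow x k

invFact : ℕ → ℚ
invFact k = (+ 1 / (k !)) {{k ℕ.!≢0}}

expSumℚ : ℚ → ℕ → ℚ
expSumℚ x zero    = ι 0
expSumℚ x (suc n) = expSumℚ x n + invFact n * pow x n

seq-^ : ∀ x k n → seq (x ^ℝ k) n ≡ pow (seq x n) k
seq-^ x zero    n = refl
seq-^ x (suc k) n = cong (seq x n *_) (seq-^ x k n)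

seq-expSum : ∀ x j n → seq (expSum x j) n ≡ expSumℚ (seq x n) j
seq-expSum x zero    n = refl
seq-expSum x (suc j) n = cong₂ _+_ (seq-expSum x j n) (cong (invFact j *_) (seq-^ x j n))

invFact*!≡1 : ∀ k → invFact k * ι (k !) ≡ 1ℚ
invFact*!≡1 k = [1/n]*n≡1 (k !) {{k ℕ.!≢0}}

0≤invFact : ∀ k → 0ℚ ≤ invFact k
0≤invFact k = nonNegative⁻¹ _ {{normalize-nonNeg 1 (k !) {{k ℕ.!≢0}}}}

invFact-suc : ∀ k → invFact (suc k) * ι (suc k) ≡ invFact k
invFact-suc k = begin
  invFact (suc k) * ι (suc k)                          ≡⟨ *-identityʳ _ ⟨
  invFact (suc k) * ι (suc k) * 1ℚ                     ≡⟨ cong (invFact (suc k) * ι (suc k) *_) (invFact*!≡1 k) ⟨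
  invFact (suc k) * ι (suc k) * (invFact k * ι (k !))     ≡⟨ rearrange (invFact (suc k)) (ι (suc k)) (invFact k) (ι (k !)) ⟩
  invFact (suc k) * (ι (suc k) * ι (k !)) * invFact k     ≡⟨ cong (λ x → invFact (suc k) * x * invFact k) (ι-* (suc k) (k !)) ⟨
  invFact (suc k) * ι (suc k !) * invFact k               ≡⟨ cong (_* invFact k) (invFact*!≡1 (suc k)) ⟩
  1ℚ * invFact k                                     ≡⟨ *-identityˡ _ ⟩
  invFact k                                          ∎
  where
  open ≡-Reasoning
  rearrange : ∀ a b c d → a * b * (c * d) ≡ a * (b * d) * c
  rearrange = solve 4 (λ a b c d → a :* b :* (c :* d) := a :* (b :* d) :* c) refl

pow-nonNeg : ∀ {x} → 0ℚ ≤ x → ∀ k → 0ℚ ≤ pow x k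
pow-nonNeg 0≤x zero    = 0≤ι 1
pow-nonNeg 0≤x (suc k) = *-nonNeg 0≤x (pow-nonNeg 0≤x k)

∣pow∣≤ : ∀ {x y} → ∣ x ∣ ≤ y → ∀ k → ∣ pow x k ∣ ≤ pow y k
∣pow∣≤ ∣x∣≤y zero = ≤-refl
∣pow∣≤ {x} {y} ∣x∣≤y (suc k) = subst (_≤ y * pow y k) (sym (∣p*q∣≡∣p∣*∣q∣ x (pow x k)))
  (*-mono-≤ (≤-trans (0≤∣p∣ x) ∣x∣≤y) (0≤∣p∣ (pow x k)) ∣x∣≤y (∣pow∣≤ ∣x∣≤y k))

p≤∣p∣ : ∀ p → p ≤ ∣ p ∣
p≤∣p∣ p with ≤-total 0ℚ p
... | inj₁ 0≤p = ≤-reflexive (sym (0≤p⇒∣p∣≡p 0≤p))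
... | inj₂ p≤0 = ≤-trans p≤0 (0≤∣p∣ p)

-- The absolute value is needed because partial sums are not monotone at negative arguments. Through
-- this lemma exp (log X) is bounded by exp |log X|.
expSumℚ-mono : ∀ {x y} → ∣ x ∣ ≤ y → ∀ n → expSumℚ x n ≤ expSumℚ y n
expSumℚ-mono ∣x∣≤y zero    = ≤-refl
expSumℚ-mono {x} ∣x∣≤y (suc n) = +-mono-≤ (expSumℚ-mono ∣x∣≤y n)
  (*-monoˡ-≤-nonNeg (invFact n) {{nonNegative (0≤invFact n)}} (≤-trans (p≤∣p∣ (pow x n)) (∣pow∣≤ ∣x∣≤y n)))

-- The increment of a power is at most h times the derivative at the right endpoint. The induction
-- step weakens x (x + h)ᵏ to (x + h)ᵏ⁺¹.
pow-convex : ∀ {x h} → 0ℚ ≤ x → 0ℚ ≤ h → ∀ k →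
  pow (x + h) (suc k) ≤ pow x (suc k) + ι (suc k) * (h * pow (x + h) k)
pow-convex {x} {h} 0≤x 0≤h zero = ≤-reflexive (identity x h)
  where
  identity : ∀ x h → (x + h) * ι 1 ≡ x * ι 1 + ι 1 * (h * ι 1)
  identity = solve 2 (λ x h → (x :+ h) :* con (ι 1) := x :* con (ι 1) :+ con (ι 1) :* (h :* con (ι 1))) refl
pow-convex {x} {h} 0≤x 0≤h (suc k) = begin
  (x + h) * P′
    ≡⟨ *-distribʳ-+ P′ x h ⟩
  x * P′ + h * P′
    ≤⟨ +-monoˡ-≤ (h * P′) (*-monoˡ-≤-nonNeg x {{nonNegative 0≤x}} (pow-convex 0≤x 0≤h k)) ⟩
  x * (pow x (suc k) + K * (h * P)) + h * P′
    ≡⟨ rearrange x h (pow x (suc k)) K P P′ ⟩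
  pow x (2 ℕ.+ k) + (K * h * (x * P) + h * P′)
    ≤⟨ +-monoʳ-≤ (pow x (2 ℕ.+ k)) (+-monoˡ-≤ (h * P′)
         (*-monoˡ-≤-nonNeg (K * h) {{nonNegative (*-nonNeg (0≤ι (suc k)) 0≤h)}} xP≤P′)) ⟩
  pow x (2 ℕ.+ k) + (K * h * P′ + h * P′)
    ≡⟨ cong (λ z → pow x (2 ℕ.+ k) + z) (collect K h P′) ⟩
  pow x (2 ℕ.+ k) + (ι 1 + K) * (h * P′)
    ≡⟨ cong (λ z → pow x (2 ℕ.+ k) + z * (h * P′)) (ι-+ 1 (suc k)) ⟨
  pow x (2 ℕ.+ k) + ι (2 ℕ.+ k) * (h * P′) ∎
  where
  open ≤-Reasoning
  K = ι (suc k)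
  P = pow (x + h) k
  P′ = pow (x + h) (suc k)
  xP≤P′ : x * P ≤ P′
  xP≤P′ = *-monoʳ-≤-nonNeg P {{nonNegative (pow-nonNeg (+-nonNeg 0≤x 0≤h) k)}}
    (subst (_≤ x + h) (+-identityʳ x) (+-monoʳ-≤ x 0≤h))
  rearrange : ∀ x h p K P P′ → x * (p + K * (h * P)) + h * P′ ≡ x * p + (K * h * (x * P) + h * P′)
  rearrange = solve 6 (λ x h p K P P′ → x :* (p :+ K :* (h :* P)) :+ h :* P′
    := x :* p :+ (K :* h :* (x :* P) :+ h :* P′)) refl
  collect : ∀ K h P → K * h * P + h * P ≡ (ι 1 + K) * (h * P)
  collect = solve 3 (λ K h P → K :* h :* P :+ h :* P := (con (ι 1) :+ K) :* (h :* P)) refl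

-- The mean value inequality exp (x + h) - exp x ≤ h exp (x + h), for partial sums.
expSumℚ-convex : ∀ {x h} → 0ℚ ≤ x → 0ℚ ≤ h → ∀ n →
  expSumℚ (x + h) (suc n) ≤ expSumℚ x (suc n) + h * expSumℚ (x + h) n
expSumℚ-convex {x} {h} 0≤x 0≤h zero = ≤-reflexive (sym
  (trans (cong (λ z → expSumℚ x 1 + z) (*-zeroʳ h)) (+-identityʳ (expSumℚ x 1))))
expSumℚ-convex {x} {h} 0≤x 0≤h (suc n) = begin
  expSumℚ (x + h) (suc n) + e′ * pow (x + h) (suc n)
    ≤⟨ +-mono-≤ (expSumℚ-convex 0≤x 0≤h n)
         (*-monoˡ-≤-nonNeg e′ {{nonNegative (0≤invFact (suc n))}} (pow-convex 0≤x 0≤h n)) ⟩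
  expSumℚ x (suc n) + h * E + e′ * (pow x (suc n) + ι (suc n) * (h * P))
    ≡⟨ rearrange (expSumℚ x (suc n)) h E e′ (pow x (suc n)) (ι (suc n)) P ⟩
  expSumℚ x (2 ℕ.+ n) + h * (E + e′ * ι (suc n) * P)
    -- The derivative of the term of degree n + 1 is the term of degree n, which is why the sum
    -- multiplied by h is one term shorter.
    ≡⟨ cong (λ z → expSumℚ x (2 ℕ.+ n) + h * (E + z * P)) (invFact-suc n) ⟩
  expSumℚ x (2 ℕ.+ n) + h * (E + invFact n * P) ∎
  where
  open ≤-Reasoning
  e′ = invFact (suc n)
  E = expSumℚ (x + h) n
  P = pow (x + h) n
  rearrange : ∀ S h E e p N P → S + h * E + e * (p + N * (h * P)) ≡ S + e * p + h * (E + e * N * P)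
  rearrange = solve 7 (λ S h E e p N P → S :+ h :* E :+ e :* (p :+ N :* (h :* P))
    := S :+ e :* p :+ h :* (E :+ e :* N :* P)) refl

-- The mean value inequality with h = ¼, its shorter sum enlarged to the full one, leaves ¾ exp (x +
-- ¼) ≤ exp x.
expSumℚ-step : ∀ {x} → 0ℚ ≤ x → ∀ n → ι 3 * expSumℚ (x + ¼) n ≤ ι 4 * expSumℚ x n
expSumℚ-step 0≤x zero = ≤-refl
expSumℚ-step {x} 0≤x (suc n) = ≤-linear (*-monoˡ-≤-nonNeg (ι 4) bound)
  (identity (expSumℚ (x + ¼) (suc n)) (expSumℚ x (suc n)))
  where
  0≤¼ : 0ℚ ≤ ¼
  0≤¼ = from-yes (0ℚ ≤? ¼)
  E≤E′ : expSumℚ (x + ¼) n ≤ expSumℚ (x + ¼) (suc n)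
  E≤E′ = subst (_≤ expSumℚ (x + ¼) (suc n)) (+-identityʳ _)
    (+-monoʳ-≤ (expSumℚ (x + ¼) n) (*-nonNeg (0≤invFact n) (pow-nonNeg (+-nonNeg 0≤x 0≤¼) n)))
  bound : expSumℚ (x + ¼) (suc n) ≤ expSumℚ x (suc n) + ¼ * expSumℚ (x + ¼) (suc n)
  bound = ≤-trans (expSumℚ-convex 0≤x 0≤¼ n)
    (+-monoʳ-≤ (expSumℚ x (suc n)) (*-monoˡ-≤-nonNeg ¼ E≤E′))
  identity : ∀ a b → ι 4 * b + ι 4 * a ≡ ι 3 * a + ι 4 * (b + ¼ * a)
  identity = solve 2 (λ a b → con (ι 4) :* b :+ con (ι 4) :* a
    := con (ι 3) :* a :+ con (ι 4) :* (b :+ con ¼ :* a)) refl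

expSumℚ-0 : ∀ n → expSumℚ 0ℚ n ≤ 1ℚ
expSumℚ-0 zero    = from-yes (0ℚ ≤? 1ℚ)
expSumℚ-0 (suc n) = ≤-reflexive (eq n)
  where
  eq : ∀ n → expSumℚ 0ℚ (suc n) ≡ 1ℚ
  eq zero    = refl
  eq (suc n) = trans (cong₂ _+_ (eq n)
    (trans (cong (invFact (suc n) *_) (*-zeroˡ (pow 0ℚ n))) (*-zeroʳ (invFact (suc n))))) (+-identityʳ 1ℚ)

expSumℚ-¼ : ∀ n → expSumℚ ¼ n ≤ + 4 / 3
expSumℚ-¼ n = *-cancelˡ-≤-pos (ι 3) (≤-trans (expSumℚ-step ≤-refl n)
  (*-monoˡ-≤-nonNeg (ι 4) (expSumℚ-0 n)))

-- Each quarter step multiplies by at most 4/3, here relaxed to 2 so that the outcome can be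
-- compared with `Y < 2 ^ L`.
expSumℚ-m/4 : ∀ m n → expSumℚ (ι m * ¼) n ≤ ι (2 ℕ.^ m)
expSumℚ-m/4 zero    n = expSumℚ-0 n
expSumℚ-m/4 (suc m) n = *-cancelˡ-≤-pos (ι 3) (begin
  ι 3 * expSumℚ (ι (suc m) * ¼) n  ≡⟨ cong (λ z → ι 3 * expSumℚ z n)
                                          (trans (cong (_* ¼) (ι-+ 1 m)) (distrib (ι m))) ⟩
  ι 3 * expSumℚ (ι m * ¼ + ¼) n    ≤⟨ expSumℚ-step (*-nonNeg (0≤ι m) (from-yes (0ℚ ≤? ¼))) n ⟩
  ι 4 * expSumℚ (ι m * ¼) n        ≤⟨ *-monoˡ-≤-nonNeg (ι 4) (expSumℚ-m/4 m n) ⟩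
  ι 4 * ι (2 ℕ.^ m)                ≤⟨ *-monoʳ-≤-nonNeg (ι (2 ℕ.^ m)) {{nonNegative (0≤ι (2 ℕ.^ m))}}
                                         (from-yes (ι 4 ≤? ι 3 * ι 2)) ⟩
  ι 3 * ι 2 * ι (2 ℕ.^ m)          ≡⟨ *-assoc (ι 3) (ι 2) (ι (2 ℕ.^ m)) ⟩
  ι 3 * (ι 2 * ι (2 ℕ.^ m))        ≡⟨ cong (ι 3 *_) (ι-* 2 (2 ℕ.^ m)) ⟨
  ι 3 * ι (2 ℕ.^ suc m)            ∎)
  where
  open ≤-Reasoning
  distrib : ∀ m → (ι 1 + m) * ¼ ≡ m * ¼ + ¼
  distrib = solve 1 (λ m → (con (ι 1) :+ m) :* con ¼ := m :* con ¼ :+ con ¼) refl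

-- Rounding, and statements that hold eventually

archimedean : ∀ {q} → 0ℚ ≤ q → ∃[ m ] (q ≤ ι m)
archimedean {mkℚ (+ n) d-1 c} _ = n , subst (mkℚ (+ n) d-1 c ≤_) (sym (ι≡mkℚ n))
  (*≤* (ℤ.*-monoˡ-≤-nonNeg (+ n) (ℤ.+≤+ (ℕ.s≤s ℕ.z≤n))))
archimedean {mkℚ (ℤ.-[1+ n ]) d-1 c} (*≤* ())

ceilingℕ : ∀ {q} → 0ℚ ≤ q → ∃[ m ] (q ≤ ι m × ι m ≤ q + 1ℚ)
ceilingℕ {q} 0≤q = let m , q≤m = archimedean 0≤q in descend m q≤m
  where
  descend : ∀ m → q ≤ ι m → ∃[ m ] (q ≤ ι m × ι m ≤ q + 1ℚ)
  descend zero    q≤m = 0 , q≤m , +-nonNeg 0≤q (0≤ι 1)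
  descend (suc m) q≤1+m with q ≤? ι m
  ... | yes q≤m = descend m q≤m
  ... | no  q≰m = suc m , q≤1+m ,
    subst (_≤ q + 1ℚ) (trans (+-comm (ι m) (ι 1)) (sym (ι-+ 1 m))) (+-monoˡ-≤ (ι 1) (<⇒≤ (≰⇒> q≰m)))

_∧ᵉ_ : ∀ {P Q : ℕ → Set} → Eventually P → Eventually Q → Eventually (λ n → P n × Q n)
(M , p) ∧ᵉ (N , q) = M ℕ.⊔ N ,
  λ n h → p n (ℕ.m⊔n≤o⇒m≤o M N h) , q n (ℕ.m⊔n≤o⇒n≤o M N h)

infixr 3 _∧ᵉ_

mapᵉ : ∀ {P Q : ℕ → Set} → (∀ n → P n → Q n) → Eventually P → Eventually Q
mapᵉ f (N , p) = N , λ n h → f n (p n h)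

witnessᵉ : ∀ {P : ℕ → Set} → Eventually P → ∃[ n ] P n
witnessᵉ (N , p) = N , p N ℕ.≤-refl

-- Approximations to the square root and the logarithm

1/16 1/8 : ℚ
1/16 = + 1 / 16
1/8 = + 1 / 8

∣p∣*∣p∣≡p*p : ∀ p → ∣ p ∣ * ∣ p ∣ ≡ p * p
∣p∣*∣p∣≡p*p p with ∣p∣≡p∨∣p∣≡-p p
... | inj₁ eq rewrite eq = refl
... | inj₂ eq rewrite eq = solve 1 (λ p → :- p :* :- p := p :* p) refl p

square-cancel-≤ : ∀ {p q} → 0ℚ ≤ q → p * p ≤ q * q → p ≤ q
square-cancel-≤ {p} {q} 0≤q p²≤q² = ≮⇒≥ λ q<p → <-irrefl refl (<-≤-trans
  (≤-<-trans (*-monoˡ-≤-nonNeg q {{nonNegative 0≤q}} (<⇒≤ q<p))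
             (*-monoˡ-<-pos p {{positive (≤-<-trans 0≤q q<p)}} q<p))
  p²≤q²)

0<½* : ∀ {p} → 0ℚ < p → 0ℚ < ½ * p
0<½* {p} 0<p = positive⁻¹ (½ * p) {{pos*pos⇒pos ½ p {{positive 0<p}}}}

-- s² ≥ X - η/2 ≥ η/2, whereas -η/2 ≤ s < 0 would give s² ≤ η²/4 < η/2.
sqrt-nonNeg : ∀ X s → fromℕ 0 <ℝ X → IsSqrt X s → Eventually (λ n → 0ℚ ≤ seq s n)
sqrt-nonNeg X s (ε , 0<ε , X>ε) (0≤s , _ , X≤s²) =
  mapᵉ (λ n (a , b , c) → nonneg (≤-trans (p⊓q≤p ε 1ℚ) (subst (_≤ seq X n) (+-identityˡ ε) a)) b c)
    (X>ε ∧ᵉ 0≤s δ 0<δ ∧ᵉ X≤s² δ 0<δ)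
  where
  η = ε ⊓ 1ℚ
  0<η : 0ℚ < η
  0<η = [ (λ eq → subst (0ℚ <_) (sym eq) 0<ε) , (λ eq → subst (0ℚ <_) (sym eq) (from-yes (0ℚ <? 1ℚ))) ]′ (⊓-sel ε 1ℚ)
  δ = ½ * η
  0<δ : 0ℚ < δ
  0<δ = 0<½* 0<η
  nonneg : ∀ {x t} → η ≤ x → ι 0 ≤ t + δ → x ≤ t * t + δ → 0ℚ ≤ t
  nonneg {x} {t} η≤x 0≤t+δ x≤t²+δ = ≮⇒≥ λ t<0 →
    let -t≤δ : - t ≤ δ
        -t≤δ = ≤-linear 0≤t+δ (solve 2 (λ t d → d :+ con (ι 0) := :- t :+ (t :+ d)) refl t δ)
        0≤-t : 0ℚ ≤ - t
        0≤-t = neg-antimono-≤ (<⇒≤ t<0)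
        t²≤δ½ : - t * - t ≤ δ * ½
        t²≤δ½ = *-mono-≤ (<⇒≤ 0<δ) 0≤-t -t≤δ
          (≤-trans -t≤δ (*-monoˡ-≤-nonNeg ½ (p⊓q≤q ε 1ℚ)))
        η≤ : η ≤ - t * - t + δ
        η≤ = ≤-trans (≤-trans η≤x x≤t²+δ) (≤-reflexive (solve 2 (λ t d → t :* t :+ d := :- t :* :- t :+ d) refl t δ))
        ¼η≤0 : ¼ * η ≤ 0ℚ
        ¼η≤0 = ≤-linear (+-mono-≤ η≤ t²≤δ½)
          (solve 2 (λ t e → con 0ℚ :+ (e :+ :- t :* :- t) := con ¼ :* e :+ (:- t :* :- t :+ con ½ :* e :+ con ½ :* e :* con ½)) refl t η)
    in <-irrefl refl (<-≤-trans (positive⁻¹ (¼ * η) {{pos*pos⇒pos ¼ η {{positive 0<η}}}}) ¼η≤0)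

∣∣-close : ∀ {p q δ} → ∣ p - q ∣ ≤ δ → ∣ p ∣ ≤ ∣ q ∣ + δ
∣∣-close {p} {q} {δ} close = begin
  ∣ p ∣              ≡⟨ cong ∣_∣ (solve 2 (λ p q → p := q :+ (p :- q)) refl p q) ⟩
  ∣ q + (p - q) ∣    ≤⟨ ∣p+q∣≤∣p∣+∣q∣ q (p - q) ⟩
  ∣ q ∣ + ∣ p - q ∣  ≤⟨ +-monoʳ-≤ ∣ q ∣ close ⟩
  ∣ q ∣ + δ          ∎
  where open ≤-Reasoning

0<1/8 : 0ℚ < 1/8
0<1/8 = from-yes (0ℚ <? 1/8)

-- A single partial sum close to X suffices, since `B` bounds them all. The ¼ is 1/8 from the
-- convergence plus 1/8 from the definition of `_≤ℝ_`.
exp-upper : ∀ {X l y B} → IsLog X l → Eventually (λ n → ∣ seq l n ∣ ≤ y) →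
  (∀ j → expSumℚ y j ≤ B) → Eventually (λ n → seq X n ≤ B + ¼)
exp-upper {X} {l} {y} {B} isLog ∣l∣≤y bound =
  let j , _ , X≤ = witnessᵉ (isLog 1/8 0<1/8)
  in mapᵉ (λ n (X≤E , ∣ln∣≤y) → begin
       seq X n                               ≤⟨ X≤E ⟩
       seq (expSum l j) n + 1/8 + 1/8        ≡⟨ +-assoc (seq (expSum l j) n) 1/8 1/8 ⟩
       seq (expSum l j) n + ¼                ≡⟨ cong (λ z → z + ¼) (seq-expSum l j n) ⟩
       expSumℚ (seq l n) j + ¼               ≤⟨ +-monoˡ-≤ ¼ (≤-trans (expSumℚ-mono ∣ln∣≤y j) (bound j)) ⟩
       B + ¼                                 ∎)
     (X≤ 1/8 0<1/8 ∧ᵉ ∣l∣≤y)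
  where open ≤-Reasoning

-- `m` is 4 |log X| rounded up, so exp (m/4) ≤ 2ᵐ puts X below about 2ᵐ. Since X ≥ 2 keeps |log X|
-- away from 0, a multiple of it also absorbs the rounding and the additive 3.
log-lower : ∀ X l → fromℕ 2 ≤ℝ X → IsLog X l →
  ∃[ m ] (Eventually (λ n → seq X n ≤ ι (2 ℕ.^ m) + ¼) ×
          Eventually (λ n → ι (m ℕ.+ 3) ≤ ι 76 * ∣ seq l n ∣))
log-lower X l 2≤X isLog = m ,
  exp-upper {X} {l} isLog (N , ∣l∣≤m/4) (expSumℚ-m/4 m) , N , λ n N≤n → final {∣ seq l n ∣} (l≥ n N≤n)
  where
  cauchy-l = cauchy l 1/16 (from-yes (0ℚ <? 1/16))
  N = proj₁ cauchy-l
  q = ∣ seq l N ∣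
  l≤ : ∀ n → N ℕ.≤ n → ∣ seq l n ∣ ≤ q + 1/16
  l≤ n N≤n = ∣∣-close {seq l n} {seq l N} (proj₂ cauchy-l n N N≤n ℕ.≤-refl)
  l≥ : ∀ n → N ℕ.≤ n → q ≤ ∣ seq l n ∣ + 1/16
  l≥ n N≤n = ∣∣-close {seq l N} {seq l n} (proj₂ cauchy-l N n ℕ.≤-refl N≤n)
  -- Beyond `N` the approximations of log X move by at most 1/16, so q + 1/16 bounds all of them.
  4q : ∃[ m ] (ι 4 * (q + 1/16) ≤ ι m × ι m ≤ ι 4 * (q + 1/16) + 1ℚ)
  4q = ceilingℕ (*-nonNeg (0≤ι 4) (+-nonNeg (0≤∣p∣ (seq l N)) (from-yes (0ℚ ≤? 1/16))))
  m = proj₁ 4q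
  ∣l∣≤m/4 : ∀ n → N ℕ.≤ n → ∣ seq l n ∣ ≤ ι m * ¼
  ∣l∣≤m/4 n N≤n = ≤-linear (+-mono-≤ (*-monoʳ-≤-nonNeg ¼ (proj₁ (proj₂ 4q))) (l≤ n N≤n))
    (solve 3 (λ m q x → m :* con ¼ :+ (con (ι 4) :* (q :+ con 1/16) :* con ¼ :+ x)
      := x :+ (m :* con ¼ :+ (q :+ con 1/16))) refl (ι m) q ∣ seq l n ∣)
  -- Otherwise |l| ≤ 3/16 in the limit, so that exp l ≤ 4/3 < 2.
  q>1/8 : 1/8 < q
  q>1/8 = ≰⇒> λ q≤1/8 →
    let n , X≤ , 2≤ = witnessᵉ
          (exp-upper {X} {l} {¼} isLog
             (N , λ n N≤n → ≤-trans (l≤ n N≤n) (≤-trans (+-monoˡ-≤ 1/16 q≤1/8) (from-yes (1/8 + 1/16 ≤? ¼))))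
             expSumℚ-¼
           ∧ᵉ 2≤X ¼ (from-yes (0ℚ <? ¼)))
    in from-no (ι 2 ≤? + 4 / 3 + ¼ + ¼) (≤-trans 2≤ (+-monoˡ-≤ ¼ X≤))
  final : ∀ {x} → q ≤ x + 1/16 → ι (m ℕ.+ 3) ≤ ι 76 * x
  -- Here m + 3 ≤ 4q + 17/4 and x ≥ q - 1/16. The factor 76 solves 4q + 17/4 = 76 (q - 1/16) at q =
  -- 1/8, and larger q only helps.
  final {x} q≤ = subst (_≤ ι 76 * x) (sym (ι-+ m 3)) (≤-linear
    (+-mono-≤ (+-mono-≤ (proj₂ (proj₂ 4q)) (*-monoˡ-≤-nonNeg (ι 76) q≤)) (*-monoˡ-≤-nonNeg (ι 72) (<⇒≤ q>1/8)))
    (solve 3 (λ m q x → con (ι 76) :* x :+ (m :+ con (ι 76) :* q :+ con (ι 72) :* con 1/8)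
      := m :+ con (ι 3) :+ (con (ι 4) :* (q :+ con 1/16) :+ con 1ℚ :+ con (ι 76) :* (x :+ con 1/16) :+ con (ι 72) :* q))
      refl (ι m) q x))

-- Integer substitutes for X and its square root

isqrt : ∀ n → ∃[ r ] (r ℕ.* r ℕ.≤ n × n ℕ.< suc r ℕ.* suc r)
isqrt zero    = 0 , ℕ.z≤n , ℕ.z<s
isqrt (suc n) with isqrt n
... | r , r²≤n , n< with suc r ℕ.* suc r ℕ.≤? suc n
... | yes 1+r²≤ = suc r , 1+r²≤ , ℕ.≤-<-trans n< (ℕ.*-mono-< (ℕ.n<1+n (suc r)) (ℕ.n<1+n (suc r)))
... | no  1+r²≰ = r , ℕ.m≤n⇒m≤1+n r²≤n , ℕ.≰⇒> 1+r²≰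

ceiling-upper : ∀ {k n₀ p x} → ι k ≤ p + 1ℚ → ∣ p ∣ ≤ ∣ x ∣ + 1ℚ → ∣ x ∣ ≤ ι n₀ → k ℕ.≤ n₀ ℕ.+ 2
ceiling-upper {k} {n₀} {p} {x} k≤ p≤ x≤ = ι-cancel-≤ {k} {n₀ ℕ.+ 2} (begin
  ι k                    ≤⟨ k≤ ⟩
  p + 1ℚ                 ≤⟨ +-monoˡ-≤ 1ℚ (≤-trans (p≤∣p∣ p) p≤) ⟩
  ∣ x ∣ + 1ℚ + 1ℚ        ≤⟨ +-monoˡ-≤ 1ℚ (+-monoˡ-≤ 1ℚ x≤) ⟩
  ι n₀ + 1ℚ + 1ℚ         ≡⟨ +-assoc (ι n₀) 1ℚ 1ℚ ⟩
  ι n₀ + ι 2             ≡⟨ ι-+ n₀ 2 ⟨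
  ι (n₀ ℕ.+ 2)           ∎)
  where open ≤-Reasoning

ceiling-lower : ∀ {n₀ p x} → 1ℚ ≤ p → ∣ x ∣ ≤ ∣ p ∣ + 1ℚ → ι n₀ ≤ ∣ x ∣ + 1ℚ → ι (n₀ ℕ.+ 2) ≤ p + ι 4
ceiling-lower {n₀} {p} {x} 1≤p x≤ n₀≤ = begin
  ι (n₀ ℕ.+ 2)               ≡⟨ ι-+ n₀ 2 ⟩
  ι n₀ + ι 2                 ≤⟨ +-monoˡ-≤ (ι 2) n₀≤ ⟩
  ∣ x ∣ + 1ℚ + ι 2           ≤⟨ +-monoˡ-≤ (ι 2) (+-monoˡ-≤ 1ℚ x≤) ⟩
  ∣ p ∣ + 1ℚ + 1ℚ + ι 2      ≡⟨ cong (λ z → z + 1ℚ + 1ℚ + ι 2) (0≤p⇒∣p∣≡p (≤-trans (from-yes (0ℚ ≤? 1ℚ)) 1≤p)) ⟩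
  p + 1ℚ + 1ℚ + ι 2          ≡⟨ solve 1 (λ x → x :+ con 1ℚ :+ con 1ℚ :+ con (ι 2) := x :+ con (ι 4)) refl p ⟩
  p + ι 4                    ∎
  where open ≤-Reasoning

2≤p+1⇒1≤p : ∀ {p} → ι 2 ≤ p + 1ℚ → 1ℚ ≤ p
2≤p+1⇒1≤p {p} 2≤ = ≤-linear 2≤ (solve 1 (λ x → x :+ con (ι 2) := con 1ℚ :+ (x :+ con 1ℚ)) refl p)

-- Let x be an approximation from which later ones differ by at most 1, and n₀ = ⌈|x|⌉. An integer k
-- ≤ X satisfies k ≤ |x| + 2 ≤ n₀ + 2, and n₀ + 2 ≤ |x| + 3 is at most 4 above every late
-- approximation of X. These are positive because X ≥ 2.
floor-bound : ∀ X → fromℕ 2 ≤ℝ X →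
  ∃[ M ] ((∀ k → fromℕ k ≤ℝ X → k ℕ.≤ M) × Eventually (λ n → 1ℚ ≤ seq X n × ι M ≤ seq X n + ι 4))
floor-bound X 2≤X with N , cauchy-X ← cauchy X 1ℚ (from-yes (0ℚ <? 1ℚ))
                  with n₀ , x≤n₀ , n₀≤x ← ceilingℕ (0≤∣p∣ (seq X N)) =
  n₀ ℕ.+ 2 , upper , mapᵉ lower (2≤X 1ℚ (from-yes (0ℚ <? 1ℚ)) ∧ᵉ close)
  where
  x = seq X N
  close : Eventually (λ n → ∣ seq X n ∣ ≤ ∣ x ∣ + 1ℚ × ∣ x ∣ ≤ ∣ seq X n ∣ + 1ℚ)
  close = N , λ n N≤n →
    ∣∣-close {seq X n} {x} (cauchy-X n N N≤n ℕ.≤-refl) ,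
    ∣∣-close {x} {seq X n} (cauchy-X N n ℕ.≤-refl N≤n)
  upper : ∀ k → fromℕ k ≤ℝ X → k ℕ.≤ n₀ ℕ.+ 2
  upper k k≤X =
    let n , k≤ , X≤ , _ = witnessᵉ (k≤X 1ℚ (from-yes (0ℚ <? 1ℚ)) ∧ᵉ close)
    in ceiling-upper {k} {n₀} {seq X n} {x} k≤ X≤ x≤n₀
  lower : ∀ n → ι 2 ≤ seq X n + 1ℚ × ∣ seq X n ∣ ≤ ∣ x ∣ + 1ℚ × ∣ x ∣ ≤ ∣ seq X n ∣ + 1ℚ →
          1ℚ ≤ seq X n × ι (n₀ ℕ.+ 2) ≤ seq X n + ι 4
  lower n (2≤ , _ , x≤) = 2≤p+1⇒1≤p 2≤ , ceiling-lower {n₀} {seq X n} {x} (2≤p+1⇒1≤p 2≤) x≤ n₀≤x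

-- Y² ≤ x + 4 and 16 t² ≥ 16 x - 8, and x + 4 ≤ 16 x - 8 follows from x ≥ 1 with 3 to spare.
isqrt≤4√ : ∀ {Y M x t} → Y ℕ.* Y ℕ.≤ M → 0ℚ ≤ t → 1ℚ ≤ x → ι M ≤ x + ι 4 → x ≤ t * t + ½ → ι Y ≤ ι 4 * t
isqrt≤4√ {Y} {M} {x} {t} Y²≤M 0≤t 1≤x M≤ x≤ = square-cancel-≤ (*-nonNeg (0≤ι 4) 0≤t)
  (≤-linear
    (+-mono-≤ (+-mono-≤ (+-mono-≤ Y²≤ (*-monoˡ-≤-nonNeg (ι 16) x≤)) (*-monoˡ-≤-nonNeg (ι 15) 1≤x)) (0≤ι 3))
    (solve 3 (λ y x t → con (ι 4) :* t :* (con (ι 4) :* t) :+ (y :* y :+ con (ι 16) :* x :+ con (ι 15) :* con 1ℚ :+ con 0ℚ)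
      := y :* y :+ (x :+ con (ι 4) :+ con (ι 16) :* (t :* t :+ con ½) :+ con (ι 15) :* x :+ con (ι 3))) refl (ι Y) x t))
  where
  Y²≤ : ι Y * ι Y ≤ x + ι 4
  Y²≤ = ≤-trans (subst (_≤ ι M) (ι-* Y Y) (ι-mono-≤ {Y ℕ.* Y} {M} Y²≤M)) M≤

-- Giving up the square by Y ≤ Y² costs only a constant factor in the exponent; 2ᵐ + 5 is then below
-- 8 · 2ᵐ.
isqrt<2^ : ∀ {Y M m x} → Y ℕ.* Y ℕ.≤ M → ι M ≤ x + ι 4 → x ≤ ι (2 ℕ.^ m) + ¼ → Y ℕ.< 2 ℕ.^ (m ℕ.+ 3)
isqrt<2^ {Y} {M} {m} {x} Y²≤M M≤ x≤ = begin-strict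
  Y                    ≤⟨ ≤-square Y ⟩
  Y ℕ.* Y              ≤⟨ Y²≤M ⟩
  M                    ≤⟨ ι-cancel-≤ {M} {2 ℕ.^ m ℕ.+ 5} M≤2^m+5 ⟩
  2 ℕ.^ m ℕ.+ 5        <⟨ ℕ.+-monoʳ-< (2 ℕ.^ m) (ℕ.m≤n+m 6 1) ⟩
  2 ℕ.^ m ℕ.+ 7        ≤⟨ ℕ.+-monoʳ-≤ (2 ℕ.^ m) (ℕ.m≤n*m 7 (2 ℕ.^ m) {{ℕ.m^n≢0 2 m}}) ⟩
  2 ℕ.^ m ℕ.+ 2 ℕ.^ m ℕ.* 7 ≡⟨ ℕ.*-suc (2 ℕ.^ m) 7 ⟨
  2 ℕ.^ m ℕ.* 8        ≡⟨ ℕ.^-distribˡ-+-* 2 m 3 ⟨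
  2 ℕ.^ (m ℕ.+ 3)      ∎
  where
  open ℕ.≤-Reasoning
  ≤-square : ∀ y → y ℕ.≤ y ℕ.* y
  ≤-square zero    = ℕ.z≤n
  ≤-square (suc y) = ℕ.m≤m*n (suc y) (suc y)
  M≤2^m+5 : ι M ≤ ι (2 ℕ.^ m ℕ.+ 5)
  M≤2^m+5 = subst (ι M ≤_) (sym (ι-+ (2 ℕ.^ m) 5)) (≤-trans M≤ (≤-trans (+-monoˡ-≤ (ι 4) x≤)
    (≤-trans (≤-reflexive (+-assoc (ι (2 ℕ.^ m)) ¼ (ι 4)))
      (+-monoʳ-≤ (ι (2 ℕ.^ m)) (from-yes (¼ + ι 4 ≤? ι 5))))))

-- The constant and the final estimate

cube : ℕ → ℕ
cube C = C ℕ.* C ℕ.* C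

-- 76 and 4 come from L ≤ 76 |log X| (log-lower) and Y ≤ 4 √X (isqrt≤4√).
constant : ℤ → ℕ
constant Δ = cube (4 ℕ.^ ℤ.∣ Δ ∣) ℕ.* (76 ℕ.* 76 ℕ.* 4)

-- Stated for one approximation at a time: `l * (l * ι 1)` is what `logX ^ℝ 2` unfolds to at an
-- index. Squaring removes the absolute value.
collect-count : ∀ C L Y {s l} → 0ℚ ≤ s → ι L ≤ ι 76 * ∣ l ∣ → ι Y ≤ ι 4 * s →
  ι (countBound C L Y) ≤ ι (cube C ℕ.* (76 ℕ.* 76 ℕ.* 4)) * s * (l * (l * ι 1))
collect-count C L Y {s} {l} 0≤s L≤ Y≤ = begin
  ι (countBound C L Y)
    ≡⟨ cong ι (regroup C L Y) ⟩
  ι (cube C ℕ.* (L ℕ.* L ℕ.* Y))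
    ≡⟨ trans (ι-* (cube C) (L ℕ.* L ℕ.* Y)) (cong (ι (cube C) *_) (trans (ι-* (L ℕ.* L) Y) (cong (_* ι Y) (ι-* L L)))) ⟩
  ι (cube C) * (ι L * ι L * ι Y)
    ≤⟨ *-monoˡ-≤-nonNeg (ι (cube C)) {{nonNegative (0≤ι (cube C))}}
         (*-mono-≤ (*-nonNeg 0≤76l 0≤76l) (0≤ι Y) (*-mono-≤ 0≤76l (0≤ι L) L≤ L≤) Y≤) ⟩
  ι (cube C) * (ι 76 * ∣ l ∣ * (ι 76 * ∣ l ∣) * (ι 4 * s))
    ≡⟨ solve 3 (λ D a s → D :* (con (ι 76) :* a :* (con (ι 76) :* a) :* (con (ι 4) :* s))
         := D :* con (ι (76 ℕ.* 76 ℕ.* 4)) :* s :* (a :* a)) refl (ι (cube C)) ∣ l ∣ s ⟩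
  ι (cube C) * ι (76 ℕ.* 76 ℕ.* 4) * s * (∣ l ∣ * ∣ l ∣)
    ≡⟨ cong₂ (λ c z → c * s * z) (sym (ι-* (cube C) (76 ℕ.* 76 ℕ.* 4)))
         (trans (∣p∣*∣p∣≡p*p l) (cong (l *_) (sym (*-identityʳ l)))) ⟩
  ι (cube C ℕ.* (76 ℕ.* 76 ℕ.* 4)) * s * (l * (l * ι 1)) ∎
  where
  open ≤-Reasoning
  0≤76l : 0ℚ ≤ ι 76 * ∣ l ∣
  0≤76l = *-nonNeg (0≤ι 76) (0≤∣p∣ l)
  regroup : ∀ C L Y → C ℕ.* (C ℕ.* (C ℕ.* (L ℕ.* (L ℕ.* 1)))) ℕ.* Y ≡ C ℕ.* C ℕ.* C ℕ.* (L ℕ.* L ℕ.* Y)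
  regroup = solve-∀

inRange⇒X≮1 : ∀ {Δ X t} → InRange Δ X t → ¬ (X <ℝ fromℕ 1)
inRange⇒X≮1 {X = X} {t} ir (ε , 0<ε , X+ε≤1)
  with n , X+ε≤ , lcm≤ ← witnessᵉ (X+ε≤1 ∧ᵉ InRange.lcm≤X ir (½ * ε) (0<½* 0<ε)) =
  <-irrefl refl (<-≤-trans (0<½* 0<ε) (≤-linear
    (+-mono-≤ X+ε≤ (≤-trans (ι-mono-≤ {1} {lcmOf t} (lcmOf>0 ir)) lcm≤))
    (solve 2 (λ x e → con 0ℚ :+ (x :+ e :+ con (ι 1))
      := con ½ :* e :+ (con (ι 1) :+ (x :+ con ½ :* e))) refl (seq X n) ε)))

≤+ε : ∀ {p q ε} → 0ℚ < ε → p ≤ q → p ≤ q + ε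
≤+ε {p} {q} 0<ε p≤q = subst (_≤ q + _) (+-identityʳ p) (+-mono-≤ p≤q (<⇒≤ 0<ε))

count-large : ∀ {Δ} → Δ ≢ 0ℤ → (X √X logX : ℝ) (M m Y : ℕ) → fromℕ 0 <ℝ X → IsSqrt X √X →
  (∀ k → fromℕ k ≤ℝ X → k ℕ.≤ M) →
  Eventually (λ n → 1ℚ ≤ seq X n × ι M ≤ seq X n + ι 4) →
  Eventually (λ n → seq X n ≤ ι (2 ℕ.^ m) + ¼) →
  Eventually (λ n → ι (m ℕ.+ 3) ≤ ι 76 * ∣ seq logX n ∣) →
  Y ℕ.* Y ℕ.≤ M → M ℕ.< suc Y ℕ.* suc Y →
  CountAtMost (InRange Δ X) (fromℕ (constant Δ) *ℝ √X *ℝ logX ^ℝ 2)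
count-large {Δ} Δ≢0 X √X logX M m Y 0<X isSqrt@(_ , _ , X≤s²) k≤M M≤X+4 X≤2^m L≤log Y²≤M M< as as! inRange ε 0<ε =
  mapᵉ (λ n (0≤s , (1≤x , M≤) , x≤ , L≤) → ≤+ε 0<ε (≤-trans
      (ι-mono-≤ {length as} {countBound C L Y} count)
      (collect-count C L Y {seq √X n} {seq logX n} 0≤s L≤
        (isqrt≤4√ {Y} {M} {seq X n} Y²≤M 0≤s 1≤x M≤ x≤))))
    (sqrt-nonNeg X √X 0<X isSqrt ∧ᵉ M≤X+4 ∧ᵉ X≤s² ½ (from-yes (0ℚ <? ½)) ∧ᵉ L≤log)
  where
  C = 4 ℕ.^ ℤ.∣ Δ ∣
  L = m ℕ.+ 3
  Y<2^L : Y ℕ.< 2 ℕ.^ L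
  -- One index at which both estimates hold is enough, the conclusion being about natural numbers.
  Y<2^L = let n , (_ , M≤) , x≤ = witnessᵉ (M≤X+4 ∧ᵉ X≤2^m)
          in isqrt<2^ {Y} {M} {m} {seq X n} Y²≤M M≤ x≤
  count : length as ℕ.≤ countBound C L Y
  count = cover⇒length≤ (inRange-cover {Δ} {X} Δ≢0 {L} {Y} Y<2^L) as as!
    (All.map (λ {t} ir → ir , ℕ.≤-<-trans (k≤M (lcmOf t) (InRange.lcm≤X ir)) M<) inRange)

lemma4p3 : (Δ : ℤ) → Δ ≢ 0ℤ →
    ∃[ c ] ((X : ℝ) → fromℕ 0 <ℝ X →
      -- At X = 1 the left side is 1 and log X = 0, so the bound fails for X
      -- in [1, 1 + η) with η > 0 small; the window [1, 2) is left out.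
      X <ℝ fromℕ 1 ⊎ fromℕ 2 ≤ℝ X →
      (√X logX : ℝ) → IsSqrt X √X → IsLog X logX →
      CountAtMost (InRange Δ X) (c *ℝ √X *ℝ logX ^ℝ 2))
lemma4p3 Δ Δ≢0 = fromℕ (constant Δ) , bound
  where
  C = 4 ℕ.^ ℤ.∣ Δ ∣
  bound : (X : ℝ) → fromℕ 0 <ℝ X → X <ℝ fromℕ 1 ⊎ fromℕ 2 ≤ℝ X →
    (√X logX : ℝ) → IsSqrt X √X → IsLog X logX →
    CountAtMost (InRange Δ X) (fromℕ (constant Δ) *ℝ √X *ℝ logX ^ℝ 2)
  bound X 0<X (inj₁ X<1) √X logX isSqrt isLog [] _ _ ε 0<ε =
    -- For the empty list only non-negativity of the right side is at stake; `collect-count` with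
    -- both counts 0 supplies it.
    mapᵉ (λ n 0≤s → ≤+ε 0<ε (≤-trans (0≤ι (countBound C 0 0)) (collect-count C 0 0 {seq √X n} {seq logX n} 0≤s
        (*-nonNeg (0≤ι 76) (0≤∣p∣ (seq logX n))) (*-nonNeg (0≤ι 4) 0≤s))))
      (sqrt-nonNeg X √X 0<X isSqrt)
  bound X 0<X (inj₁ X<1) √X logX isSqrt isLog (_ ∷ _) _ (ir ∷ _) =
    contradiction X<1 (inRange⇒X≮1 ir)
  bound X 0<X (inj₂ 2≤X) √X logX isSqrt isLog =
    let M , k≤M , M≤X+4 = floor-bound X 2≤X
        m , X≤2^m , L≤log = log-lower X logX 2≤X isLog
        Y , Y²≤M , M< = isqrt M
    in count-large Δ≢0 X √X logX M m Y 0<X isSqrt k≤M M≤X+4 X≤2^m L≤log Y²≤M M<
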